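{- Let $n\ge3$, let $(c_u)_{u\in\mathbb Z}$ be the quiddity of a triangulation $\mathbb T$ of an $n$-gon, and let $\{\zeta_{k,\ell}\}$ be the $q$-deformed Conway--Coxeter frieze of $\mathbb T$. Let $i,j\in\mathbb Z$ with $i\le j\le i+n-2$, and write $$M_q(c_i,c_{i+1},\dots,c_j)=\begin{pmatrix}\mathcal R&-q^{c_j-1}\mathcal R'\\ \mathcal S&-q^{c_j-1}\mathcal S'\end{pmatrix}.$$ Then: (1) $$\begin{pmatrix}\zeta_{i-1,j+1}&\zeta_{i-1,j}\\ \zeta_{i,j+1}&\zeta_{i,j}\end{pmatrix}=\begin{pmatrix}\mathcal R&\mathcal R'\\ \mathcal S&\mathcal S'\end{pmatrix},$$ where $\zeta_{i,j}=\zeta_{i,i}=\mathcal S'=0$ if $j=i$, $\zeta_{i-1,j+1}=\zeta_{i-1,i+n-1}=\mathcal R=0$ if $j=i+n-2$, and otherwise $\mathcal R',\mathcal S',\mathcal R,\mathcal S$ are nonzero polynomials. (2) $[[c_i,\dots,c_{j-1}]]_q=\dfrac{\mathcal R'}{\mathcal S'}$ and $[[c_i,\dots,c_{j-1},c_j]]_q=\dfrac{\mathcal R}{\mathcal S}$, where for $j=i$ the first (empty) continued fraction is $[[\ ]]_q=\dfrac10$.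
   Context: Triangulations. Let $n\ge3$ and let $\mathcal P$ be a convex $n$-gon with vertices numbered clockwise $v_0,\dots,v_{n-1}$; indices are extended to $\mathbb Z$ by $v_{u+n}=v_u$. A triangulation $\mathbb T$ of $\mathcal P$ is by $n-3$ non-crossing diagonals; its triangles are called cells. Let $c_u$ be the number of cells having $v_u$ as a vertex; the $n$-periodic sequence $(c_u)_{u\in\mathbb Z}$ is the quiddity of $\mathbb T$. For an integer $a\ge0$ put $[a]_q=1+q+\cdots+q^{a-1}$ (with $[0]_q=0$). $q$-deformed Conway--Coxeter frieze of $\mathbb T$: the array $\zeta_{k,\ell}$, for integers $k,\ell$ with $0\le\ell-k\le n+1$, determined by $\zeta_{k,k}=0$, $\zeta_{k,k+1}=1$, $\zeta_{k,k+2}=[c_{k+1}]_q$ and, recursively for $\ell-k\ge3$, by solving for $\zeta_{k,\ell}$ in the $q$-unimodular rule $$\zeta_{k,\ell-1}\zeta_{k+1,\ell}-\zeta_{k+1,\ell-1}\zeta_{k,\ell}=q^{\sum_{u=k+1}^{\ell-2}(c_u-1)}.$$ (That the divisors $\zeta_{k+1,\ell-1}$ needed here are nonzero, and that the entries are polynomials in $\mathbb Z[q]$, is part of what the proposition establishes.) Matrices: $$M_q(c_i,\dots,c_j)=\begin{pmatrix}[c_i]_q&-q^{c_i-1}\\1&0\end{pmatrix}\begin{pmatrix}[c_{i+1}]_q&-q^{c_{i+1}-1}\\1&0\end{pmatrix}\cdots\begin{pmatrix}[c_j]_q&-q^{c_j-1}\\1&0\end{pmatrix}.$$ $q$-deformed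 negative continued fractions, with values in $\mathbb P^1(\mathbb Q(q))=\mathbb Q(q)\cup\{\tfrac10\}$: $[[\ ]]_q=\tfrac10$, $[[c_j]]_q=[c_j]_q$, and $$[[c_i,\dots,c_j]]_q=[c_i]_q-\frac{q^{c_i-1}}{[[c_{i+1},\dots,c_j]]_q}\qquad(i<j).$$ -}

module Defs where

open import Data.Empty using (⊥-elim)
open import Data.Fin.Base using (Fin; toℕ; fromℕ<) renaming (_<_ to _<ᶠ_)
import Data.Fin.Properties as Fin
open import Data.Integer.Base as ℤ using (ℤ; +_; -[1+_]; 0ℤ; 1ℤ)
import Data.Integer.Properties as ℤ
open import Data.Integer.DivMod using (_%ℕ_; n%ℕd<d)
open import Data.List.Base
  using (List; []; _∷_; _++_; map; foldr; filter; length; replicate; allFin; cartesianProduct)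
open import Data.List.Membership.Propositional using (_∈_)
import Data.List.Membership.DecPropositional as DecMembership
open import Data.List.Relation.Unary.Unique.Propositional using (Unique)
open import Data.Maybe.Base using (Maybe; just; nothing; _>>=_)
open import Data.Maybe.Relation.Binary.Pointwise using (Pointwise)
open import Data.Nat.ListAction using (sum)
open import Data.Nat.Base as ℕ using (ℕ; zero; suc; pred; NonZero)
import Data.Nat.Properties as ℕ using (_≟_)
open import Data.Product.Base using (_×_; _,_)
open import Data.Product.Properties using () renaming (≡-dec to ×-≡-dec)
open import Data.Sum.Base using (_⊎_; inj₁; inj₂)
open import Relation.Binary.PropositionalEquality
  using (_≡_; refl; sym; trans; cong; module ≡-Reasoning)
open import Relation.Nullary.Decidable using (Dec; yes; no; _×-dec_; _⊎-dec_)
open import Relation.Nullary.Negation using (¬_)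

infixl 6 _+ᵖ_ _-ʳ_
infixl 7 _*ᵖ_ _·ᵖ_ _*ʳ_ _⊗_
infix  4 _≈ᵖ_ _≉ᵖ_ _≈ʳ_ _≈¹_ _≐_

------------------------------------------------------------------------
-- The ring ℤ[q].  A list holds the coefficients of 1, q, q², …; trailing
-- zeros are allowed, so polynomials are compared by _≈ᵖ_, not by _≡_.

ℤ[q] : Set
ℤ[q] = List ℤ

coeff : ℤ[q] → ℕ → ℤ
coeff []      _       = 0ℤ
coeff (a ∷ p) zero    = a
coeff (a ∷ p) (suc m) = coeff p m

record _≈ᵖ_ (p r : ℤ[q]) : Set where
  constructor coeffwise
  field coeff-≡ : ∀ m → coeff p m ≡ coeff r m
open _≈ᵖ_ public

_≉ᵖ_ : ℤ[q] → ℤ[q] → Set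
p ≉ᵖ r = ¬ (p ≈ᵖ r)

0ᵖ 1ᵖ : ℤ[q]
0ᵖ = []
1ᵖ = 1ℤ ∷ []

_+ᵖ_ : ℤ[q] → ℤ[q] → ℤ[q]
[]      +ᵖ r       = r
(a ∷ p) +ᵖ []      = a ∷ p
(a ∷ p) +ᵖ (b ∷ r) = (a ℤ.+ b) ∷ (p +ᵖ r)

_·ᵖ_ : ℤ → ℤ[q] → ℤ[q]
a ·ᵖ p = map (a ℤ.*_) p

-ᵖ_ : ℤ[q] → ℤ[q]
-ᵖ p = map ℤ.-_ p

_*ᵖ_ : ℤ[q] → ℤ[q] → ℤ[q]
[]      *ᵖ r = []
(a ∷ p) *ᵖ r = a ·ᵖ r +ᵖ (0ℤ ∷ p *ᵖ r)

q^_ : ℕ → ℤ[q]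
q^ m = replicate m 0ℤ ++ 1ᵖ

[_]q : ℕ → ℤ[q]
[ a ]q = replicate a 1ℤ

-- ℤ[q] is an integral domain; this is needed to multiply denominators.

coeff-+ : ∀ p r m → coeff (p +ᵖ r) m ≡ coeff p m ℤ.+ coeff r m
coeff-+ []      r       m       = sym (ℤ.+-identityˡ _)
coeff-+ (a ∷ p) []      m       = sym (ℤ.+-identityʳ _)
coeff-+ (a ∷ p) (b ∷ r) zero    = refl
coeff-+ (a ∷ p) (b ∷ r) (suc m) = coeff-+ p r m

coeff-· : ∀ a p m → coeff (a ·ᵖ p) m ≡ a ℤ.* coeff p m
coeff-· a []      m       = sym (ℤ.*-zeroʳ a)
coeff-· a (b ∷ p) zero    = refl
coeff-· a (b ∷ p) (suc m) = coeff-· a p m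

coeff-*-zero : ∀ a p r → coeff ((a ∷ p) *ᵖ r) 0 ≡ a ℤ.* coeff r 0
coeff-*-zero a p r = begin
  coeff (a ·ᵖ r +ᵖ (0ℤ ∷ p *ᵖ r)) 0  ≡⟨ coeff-+ (a ·ᵖ r) (0ℤ ∷ p *ᵖ r) 0 ⟩
  coeff (a ·ᵖ r) 0 ℤ.+ 0ℤ            ≡⟨ ℤ.+-identityʳ _ ⟩
  coeff (a ·ᵖ r) 0                   ≡⟨ coeff-· a r 0 ⟩
  a ℤ.* coeff r 0                    ∎
  where open ≡-Reasoning

coeff-*-suc : ∀ a p r m →
  coeff ((a ∷ p) *ᵖ r) (suc m) ≡ a ℤ.* coeff r (suc m) ℤ.+ coeff (p *ᵖ r) m
coeff-*-suc a p r m = trans (coeff-+ (a ·ᵖ r) (0ℤ ∷ p *ᵖ r) (suc m))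
                            (cong (ℤ._+ coeff (p *ᵖ r) m) (coeff-· a r (suc m)))

coeff-*-shift : ∀ p r m → coeff (p *ᵖ (0ℤ ∷ r)) (suc m) ≡ coeff (p *ᵖ r) m
coeff-*-shift []      r m       = refl
coeff-*-shift (a ∷ p) r zero    = begin
  coeff ((a ∷ p) *ᵖ (0ℤ ∷ r)) 1                ≡⟨ coeff-*-suc a p (0ℤ ∷ r) 0 ⟩
  a ℤ.* coeff r 0 ℤ.+ coeff (p *ᵖ (0ℤ ∷ r)) 0  ≡⟨ cong (λ z → a ℤ.* coeff r 0 ℤ.+ z) (const p) ⟩
  a ℤ.* coeff r 0 ℤ.+ 0ℤ                       ≡⟨ ℤ.+-identityʳ _ ⟩
  a ℤ.* coeff r 0                              ≡⟨ coeff-*-zero a p r ⟨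
  coeff ((a ∷ p) *ᵖ r) 0                       ∎
  where
  open ≡-Reasoning
  const : ∀ s → coeff (s *ᵖ (0ℤ ∷ r)) 0 ≡ 0ℤ
  const []      = refl
  const (b ∷ s) = trans (coeff-*-zero b s (0ℤ ∷ r)) (ℤ.*-zeroʳ b)
coeff-*-shift (a ∷ p) r (suc m) = begin
  coeff ((a ∷ p) *ᵖ (0ℤ ∷ r)) (2 ℕ.+ m)
    ≡⟨ coeff-*-suc a p (0ℤ ∷ r) (suc m) ⟩
  a ℤ.* coeff r (suc m) ℤ.+ coeff (p *ᵖ (0ℤ ∷ r)) (suc m)
    ≡⟨ cong (λ z → a ℤ.* coeff r (suc m) ℤ.+ z) (coeff-*-shift p r m) ⟩
  a ℤ.* coeff r (suc m) ℤ.+ coeff (p *ᵖ r) m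
    ≡⟨ coeff-*-suc a p r m ⟨
  coeff ((a ∷ p) *ᵖ r) (suc m) ∎
  where open ≡-Reasoning

0∷-≈0 : ∀ {a p} → a ≡ 0ℤ → p ≈ᵖ 0ᵖ → a ∷ p ≈ᵖ 0ᵖ
0∷-≈0 a≡0 p≈0 .coeff-≡ zero    = a≡0
0∷-≈0 a≡0 p≈0 .coeff-≡ (suc m) = coeff-≡ p≈0 m

*-cancel-≈0 : ∀ {a} p r → ¬ (a ≡ 0ℤ) → (a ∷ p) *ᵖ r ≈ᵖ 0ᵖ → r ≈ᵖ 0ᵖ
*-cancel-≈0 p []      a≢0 pr≈0 = coeffwise λ _ → refl
*-cancel-≈0 {a} p (b ∷ r) a≢0 pr≈0
  with ℤ.i*j≡0⇒i≡0∨j≡0 a (trans (sym (coeff-*-zero a p (b ∷ r))) (coeff-≡ pr≈0 0))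
... | inj₁ a≡0  = ⊥-elim (a≢0 a≡0)
... | inj₂ refl = 0∷-≈0 refl (*-cancel-≈0 p r a≢0 (coeffwise λ m →
                    trans (sym (coeff-*-shift (a ∷ p) r m)) (coeff-≡ pr≈0 (suc m))))

*-≈0 : ∀ p r → p *ᵖ r ≈ᵖ 0ᵖ → p ≈ᵖ 0ᵖ ⊎ r ≈ᵖ 0ᵖ
*-≈0 []      r pr≈0 = inj₁ (coeffwise λ _ → refl)
*-≈0 (a ∷ p) r pr≈0 with a ℤ.≟ 0ℤ
... | no a≢0 = inj₂ (*-cancel-≈0 p r a≢0 pr≈0)
... | yes refl with *-≈0 p r (coeffwise λ m →
        trans (sym (trans (coeff-*-suc 0ℤ p r m) (ℤ.+-identityˡ _))) (coeff-≡ pr≈0 (suc m)))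
...   | inj₁ p≈0 = inj₁ (0∷-≈0 refl p≈0)
...   | inj₂ r≈0 = inj₂ r≈0

*-≉0 : ∀ {p r} → p ≉ᵖ 0ᵖ → r ≉ᵖ 0ᵖ → p *ᵖ r ≉ᵖ 0ᵖ
*-≉0 {p} {r} p≉0 r≉0 pr≈0 with *-≈0 p r pr≈0
... | inj₁ p≈0 = p≉0 p≈0
... | inj₂ r≈0 = r≉0 r≈0

1≉0 : 1ᵖ ≉ᵖ 0ᵖ
1≉0 1≈0 with () ← coeff-≡ 1≈0 0

_≈0? : ∀ p → Dec (p ≈ᵖ 0ᵖ)
[] ≈0? = yes (coeffwise λ _ → refl)
(a ∷ p) ≈0? with a ℤ.≟ 0ℤ | p ≈0?
... | yes a≡0 | yes p≈0 = yes (0∷-≈0 a≡0 p≈0)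
... | no a≢0  | _       = no λ ap≈0 → a≢0 (coeff-≡ ap≈0 0)
... | yes _   | no p≉0  = no λ ap≈0 → p≉0 (coeffwise λ m → coeff-≡ ap≈0 (suc m))

------------------------------------------------------------------------
-- The field ℚ(q), as the field of fractions of ℤ[q].

record ℚ⟨q⟩ : Set where
  constructor mkFrac
  field
    num   : ℤ[q]
    den   : ℤ[q]
    den≉0 : den ≉ᵖ 0ᵖ
open ℚ⟨q⟩ public

_≈ʳ_ : ℚ⟨q⟩ → ℚ⟨q⟩ → Set
x ≈ʳ y = num x *ᵖ den y ≈ᵖ num y *ᵖ den x

ι : ℤ[q] → ℚ⟨q⟩
ι p = mkFrac p 1ᵖ 1≉0

_-ʳ_ _*ʳ_ : ℚ⟨q⟩ → ℚ⟨q⟩ → ℚ⟨q⟩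
x -ʳ y = mkFrac (num x *ᵖ den y +ᵖ (-ᵖ (num y *ᵖ den x))) (den x *ᵖ den y)
                (*-≉0 (den≉0 x) (den≉0 y))
x *ʳ y = mkFrac (num x *ᵖ num y) (den x *ᵖ den y) (*-≉0 (den≉0 x) (den≉0 y))

-- A fraction vanishes exactly when its numerator does.
divide : (x y : ℚ⟨q⟩) → num y ≉ᵖ 0ᵖ → ℚ⟨q⟩
divide x y y≉0 = mkFrac (num x *ᵖ den y) (den x *ᵖ num y) (*-≉0 (den≉0 x) y≉0)

-- Undefined when the divisor is zero.
_÷_ : ℚ⟨q⟩ → ℚ⟨q⟩ → Maybe ℚ⟨q⟩
x ÷ y with num y ≈0?
... | yes _  = nothing
... | no y≉0 = just (divide x y y≉0)

------------------------------------------------------------------------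
-- The projective line ℙ¹(ℚ(q)) = ℚ(q) ∪ {1/0}.

data ℙ¹ : Set where
  1/0 : ℙ¹
  fin : ℚ⟨q⟩ → ℙ¹

data _≈¹_ : ℙ¹ → ℙ¹ → Set where
  1/0≈ : 1/0 ≈¹ 1/0
  fin≈ : ∀ {x y} → x ≈ʳ y → fin x ≈¹ fin y

-- The point p / r of ℙ¹, meaningful when p and r are not both zero.
_/¹_ : ℤ[q] → ℤ[q] → ℙ¹
p /¹ r with r ≈0?
... | yes _  = 1/0
... | no r≉0 = fin (mkFrac p r r≉0)

-- x ⊖ y ⊘ z = x - y / z for x, y in ℚ(q), y nonzero: y / (1/0) = 0, while y / 0 and
-- x - 1/0 are 1/0.
_⊖_⊘_ : ℚ⟨q⟩ → ℚ⟨q⟩ → ℙ¹ → ℙ¹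
x ⊖ y ⊘ 1/0   = fin x
x ⊖ y ⊘ fin z with num z ≈0?
... | yes _  = 1/0
... | no z≉0 = fin (x -ʳ divide y z z≉0)

------------------------------------------------------------------------
-- 2 × 2 matrices

record Mat₂ (A : Set) : Set where
  constructor mat
  field a₁₁ a₁₂ a₂₁ a₂₂ : A
open Mat₂ public

record Entrywise {A B : Set} (_∼_ : A → B → Set) (X : Mat₂ A) (Y : Mat₂ B) : Set where
  constructor entrywise
  field
    ∼₁₁ : a₁₁ X ∼ a₁₁ Y
    ∼₁₂ : a₁₂ X ∼ a₁₂ Y
    ∼₂₁ : a₂₁ X ∼ a₂₁ Y
    ∼₂₂ : a₂₂ X ∼ a₂₂ Y
open Entrywise public

_⊗_ : Mat₂ ℤ[q] → Mat₂ ℤ[q] → Mat₂ ℤ[q]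
mat a b c d ⊗ mat a′ b′ c′ d′ =
  mat (a *ᵖ a′ +ᵖ b *ᵖ c′) (a *ᵖ b′ +ᵖ b *ᵖ d′)
      (c *ᵖ a′ +ᵖ d *ᵖ c′) (c *ᵖ b′ +ᵖ d *ᵖ d′)

------------------------------------------------------------------------
-- Triangulations of a convex polygon whose vertices are, in cyclic order,
-- the elements 0, …, n - 1 of Fin n.

-- The segment joining two vertices x and y is the pair (x , y) with x < y.
Segment : ℕ → Set
Segment n = Fin n × Fin n

Side : ∀ {n} → Segment n → Set
Side {n} (x , y) = toℕ y ≡ suc (toℕ x) ⊎ (toℕ x ≡ 0 × suc (toℕ y) ≡ n)

Diagonal : ∀ {n} → Segment n → Set
Diagonal (x , y) = x <ᶠ y × ¬ Side (x , y)

-- Two diagonals d and e meet in the interior of the polygon exactly when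
-- Cross d e or Cross e d.
Cross : ∀ {n} → Segment n → Segment n → Set
Cross (x , y) (x′ , y′) = x <ᶠ x′ × x′ <ᶠ y × y <ᶠ y′

record Triangulation (n : ℕ) : Set where
  field
    diagonals   : List (Segment n)
    isDiagonal  : ∀ {d} → d ∈ diagonals → Diagonal d
    distinct    : Unique diagonals
    count       : length diagonals ≡ n ℕ.∸ 3
    nonCrossing : ∀ {d e} → d ∈ diagonals → e ∈ diagonals → ¬ Cross d e
open Triangulation public

module _ {n : ℕ} (T : Triangulation n) where

  open DecMembership (×-≡-dec (Fin._≟_ {n}) (Fin._≟_ {n})) using (_∈?_)

  Edge : Segment n → Set
  Edge s = Side s ⊎ s ∈ diagonals T

  edge? : ∀ s → Dec (Edge s)
  edge? s@(x , y) =
    ((toℕ y ℕ.≟ suc (toℕ x)) ⊎-dec ((toℕ x ℕ.≟ 0) ×-dec (suc (toℕ y) ℕ.≟ n)))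
    ⊎-dec (s ∈? diagonals T)

  Triple : Set
  Triple = Fin n × Fin n × Fin n

  -- No diagonal of T meets the interior of a triangle all of whose edges are
  -- sides of the polygon or diagonals of T, since such a diagonal would cross
  -- an edge of the triangle.  So these triangles are the cells of T; each is
  -- listed once, by its vertices in increasing order.
  Cell : Triple → Set
  Cell (x , y , z) = (x <ᶠ y × y <ᶠ z) × Edge (x , y) × Edge (y , z) × Edge (x , z)

  cell? : ∀ t → Dec (Cell t)
  cell? (x , y , z) = ((x Fin.<? y) ×-dec (y Fin.<? z))
    ×-dec (edge? (x , y) ×-dec (edge? (y , z) ×-dec edge? (x , z)))

  cells : List Triple
  cells = filter cell? (cartesianProduct (allFin n) (cartesianProduct (allFin n) (allFin n)))

  _isVertexOf_ : Fin n → Triple → Set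
  v isVertexOf (x , y , z) = v ≡ x ⊎ v ≡ y ⊎ v ≡ z

  _isVertexOf?_ : ∀ v t → Dec (v isVertexOf t)
  v isVertexOf? (x , y , z) = (v Fin.≟ x) ⊎-dec ((v Fin.≟ y) ⊎-dec (v Fin.≟ z))

  cellCount : Fin n → ℕ
  cellCount v = length (filter (v isVertexOf?_) cells)

  quiddity : .{{_ : NonZero n}} → ℤ → ℕ
  quiddity u = cellCount (fromℕ< (n%ℕd<d u n))

------------------------------------------------------------------------
-- Below, q^{c-1} is written q^ (pred c): the terms of a quiddity are at
-- least 1, because every vertex of the polygon belongs to a cell.

-- run c k m = c_k, c_{k+1}, …, c_{k+m-1}
run : (ℤ → ℕ) → ℤ → ℕ → List ℕ
run c k zero    = []
run c k (suc m) = c k ∷ run c (ℤ.suc k) m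

-- c ⟨ i ⋯ j ⟩ = c_i, …, c_j, which is empty when j < i.
_⟨_⋯_⟩ : (ℤ → ℕ) → ℤ → ℤ → List ℕ
c ⟨ i ⋯ j ⟩ with ℤ.suc j ℤ.- i
... | + m      = run c i m
... | -[1+ _ ] = []

Mq : List ℕ → Mat₂ ℤ[q]
Mq = foldr (λ c X → mat [ c ]q (-ᵖ (q^ pred c)) 1ᵖ 0ᵖ ⊗ X) (mat 1ᵖ 0ᵖ 0ᵖ 1ᵖ)

[[_]]q : List ℕ → ℙ¹
[[ [] ]]q             = 1/0
[[ c ∷ [] ]]q         = fin (ι [ c ]q)
[[ c ∷ cs@(_ ∷ _) ]]q = ι [ c ]q ⊖ ι (q^ pred c) ⊘ [[ cs ]]q

-- friezeEntry c k m = ζ_{k,k+m}, obtained by solving the q-unimodular rule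
--   ζ_{k,ℓ-1} ζ_{k+1,ℓ} - ζ_{k+1,ℓ-1} ζ_{k,ℓ} = q^{Σ_{u=k+1}^{ℓ-2} (c_u - 1)},
-- ℓ = k + m, for ζ_{k,ℓ}.  The value is nothing if the recursion runs into a
-- zero divisor.
friezeEntry : (ℤ → ℕ) → ℤ → ℕ → Maybe ℚ⟨q⟩
friezeEntry c k 0 = just (ι 0ᵖ)
friezeEntry c k 1 = just (ι 1ᵖ)
friezeEntry c k 2 = just (ι [ c (ℤ.suc k) ]q)
friezeEntry c k (suc (suc (suc m))) =
  friezeEntry c k         (suc (suc m)) >>= λ x →
  friezeEntry c (ℤ.suc k) (suc (suc m)) >>= λ y →
  friezeEntry c (ℤ.suc k) (suc m)       >>= λ z →
  (x *ʳ y -ʳ ι (q^ sum (map pred (run c (ℤ.suc k) (suc m))))) ÷ z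

-- The entry ζ_{k,ℓ}; the frieze consists of those with 0 ≤ ℓ - k ≤ n + 1.
frieze : ∀ {n} .{{_ : NonZero n}} → Triangulation n → ℤ → ℤ → Maybe ℚ⟨q⟩
frieze T k ℓ with ℓ ℤ.- k
... | + m      = friezeEntry (quiddity T) k m
... | -[1+ _ ] = nothing

-- The entry z is defined and equal to the polynomial p.
_≐_ : Maybe ℚ⟨q⟩ → ℤ[q] → Set
z ≐ p = Pointwise _≈ʳ_ z (just (ι p))

module Submission where

-- For fixed ℓ, g(k) = ζ_{k,ℓ} solves g(v-1) = [c_v] g(v) - q^{c_v-1} g(v+1) with g(ℓ) = 0 and
-- g(ℓ-1) = 1.  Number the vertices so that ℓ-n, …, ℓ-1 go once around the polygon, and let
-- x < b < y be the vertices of a cell.  Induction over the cells below an edge xy relates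
-- g(x), g(y) to g(x+1) and to g(y-1); where two such edges meet in a cell the recurrence at b gives
--   q^{b-x-1} g(b) = q^{y-x-2} g(y) + g(x).
-- At the side from ℓ-n to ℓ-1 the relations force g(ℓ-n) = 0, and from there the last equation
-- makes all g(v) with ℓ-n < v < ℓ nonzero polynomials with nonnegative coefficients.  So the
-- recursion for the frieze never divides by zero, and it computes continuants, which are the
-- entries of M_q and, as they do not vanish, also yield the continued fractions.

open import Defs
open import Algebra.Bundles using (CommutativeRing)
import Algebra.Properties.AbelianGroup as AbelianGroup
open import Algebra.Solver.Ring.AlmostCommutativeRing using (fromCommutativeRing)
import Algebra.Solver.Ring.Simple as RingSolver
open import Data.Empty using (⊥; ⊥-elim)
open import Data.Fin.Base using (Fin; toℕ; fromℕ<)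
open import Data.Fin.Properties using (toℕ<n; toℕ-fromℕ<; toℕ-injective)
open import Data.Integer.Base as ℤ using (ℤ; 0ℤ; 1ℤ)
open import Data.Integer.DivMod using (_%ℕ_; n%ℕd<d; _/ℕ_; a≡a%ℕn+[a/ℕn]*n)
import Data.Integer.Properties as ℤ
open import Data.Integer.Tactic.RingSolver using (solve-∀)
open import Data.List.Base
  using (List; []; _∷_; _++_; _∷ʳ_; length; filter; map; allFin; cartesianProduct)
import Data.List.Membership.DecPropositional as DecMembership
open import Data.List.Membership.Propositional using (_∈_)
open import Data.List.Membership.Propositional.Properties
open import Data.List.Membership.Propositional.Properties.WithK using (unique∧set⇒bag)
open import Data.List.Properties
  using (filter-accept; filter-reject; filter-none; filter-all; filter-++; length-++; length-map)
open import Data.List.Relation.Binary.BagAndSetEquality using (∼bag⇒↭)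
open import Data.List.Relation.Binary.Permutation.Propositional using (_↭_)
open import Data.List.Relation.Binary.Permutation.Propositional.Properties
  using (filter-↭; ↭-length)
open import Data.List.Relation.Unary.All as All using (All; []; _∷_)
import Data.List.Relation.Unary.All.Properties as All
open import Data.List.Relation.Unary.AllPairs using ([]; _∷_)
open import Data.List.Relation.Unary.Any using (here; there)
open import Data.List.Relation.Unary.Unique.Propositional using (Unique)
import Data.List.Relation.Unary.Unique.Propositional.Properties as Unique
open import Data.Maybe.Base using (Maybe; just; _>>=_)
open import Data.Maybe.Relation.Binary.Pointwise using (just)
open import Data.Nat.Base as ℕ using (ℕ; zero; suc; pred; NonZero; z≤n; s≤s)
open import Data.Nat.DivMod using (m<n⇒m%n≡m)
open import Data.Nat.ListAction using (sum)
import Data.Nat.Properties as ℕ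
open import Data.Nat.Solver using (module +-*-Solver)
open import Data.Product.Base using (_×_; _,_; proj₁; proj₂; ∃-syntax)
open import Data.Product.Properties using (≡-dec)
open import Data.Sum.Base using (_⊎_; inj₁; inj₂; [_,_]′)
open import Function.Base using (_∘_)
open import Function.Bundles using (mk⇔)
open import Level using (0ℓ)
open import Relation.Binary.Definitions using (Decidable; tri<; tri≈; tri>)
open import Relation.Binary.PropositionalEquality
open import Relation.Binary.Structures using (IsEquivalence)
open import Relation.Nullary.Decidable using (Dec; yes; no; map′; _×-dec_; _⊎-dec_)
open import Relation.Nullary.Negation using (¬_)

-- The induction over cells needs a binary tree rooted at the base edge, whereas a triangulation is
-- given as an unordered list of diagonals, and its cells as a filtered list of triples. The tree
-- `Tri` comes from counting: at most y - x - 1 non-crossing chords, the base included, fit over x,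
-- ..., y, and the n - 3 diagonals together with the edge from 0 to n - 1 attain this bound.
-- Attaining it is inherited by the two halves beside the apex of a cell, so every edge that the
-- tree requires is present. The base edge moves with ℓ. One tree is re-rooted vertex by vertex, and
-- periodicity of the quiddity covers the remaining integers. The relations along an edge keep
-- powers of q on both sides, because solving them for g(x+1) or g(y-1) produces coefficients such
-- as q^{r-e}, which need not lie in ℤ[q].

module Polynomials where

  -- The commutative ring ℤ[q].

  ≈ᵖ-isEquivalence : IsEquivalence _≈ᵖ_
  ≈ᵖ-isEquivalence = record
    { refl  = coeffwise λ _ → refl
    ; sym   = λ p≈r → coeffwise λ m → sym (coeff-≡ p≈r m)
    ; trans = λ p≈r r≈s → coeffwise λ m → trans (coeff-≡ p≈r m) (coeff-≡ r≈s m)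
    }

  open IsEquivalence ≈ᵖ-isEquivalence public
    using () renaming (refl to ≈-refl; sym to ≈-sym; trans to ≈-trans)

  coeff-neg : ∀ p m → coeff (-ᵖ p) m ≡ ℤ.- coeff p m
  coeff-neg []      m       = refl
  coeff-neg (a ∷ p) zero    = refl
  coeff-neg (a ∷ p) (suc m) = coeff-neg p m

  ∷-cong : ∀ {a b p r} → a ≡ b → p ≈ᵖ r → a ∷ p ≈ᵖ b ∷ r
  ∷-cong a≡b p≈r .coeff-≡ zero    = a≡b
  ∷-cong a≡b p≈r .coeff-≡ (suc m) = coeff-≡ p≈r m

  +ᵖ-cong : ∀ {p p′ r r′} → p ≈ᵖ p′ → r ≈ᵖ r′ → p +ᵖ r ≈ᵖ p′ +ᵖ r′
  +ᵖ-cong {p} {p′} {r} {r′} p≈p′ r≈r′ .coeff-≡ m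
    rewrite coeff-+ p r m | coeff-+ p′ r′ m = cong₂ ℤ._+_ (coeff-≡ p≈p′ m) (coeff-≡ r≈r′ m)

  +ᵖ-comm : ∀ p r → p +ᵖ r ≈ᵖ r +ᵖ p
  +ᵖ-comm p r .coeff-≡ m rewrite coeff-+ p r m | coeff-+ r p m = ℤ.+-comm (coeff p m) _

  +ᵖ-assoc : ∀ p r s → (p +ᵖ r) +ᵖ s ≈ᵖ p +ᵖ (r +ᵖ s)
  +ᵖ-assoc p r s .coeff-≡ m
    rewrite coeff-+ (p +ᵖ r) s m | coeff-+ p r m | coeff-+ p (r +ᵖ s) m | coeff-+ r s m
    = ℤ.+-assoc (coeff p m) _ _

  +ᵖ-identityʳ : ∀ p → p +ᵖ 0ᵖ ≈ᵖ p
  +ᵖ-identityʳ p = +ᵖ-comm p 0ᵖ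

  neg-cong : ∀ {p r} → p ≈ᵖ r → -ᵖ p ≈ᵖ -ᵖ r
  neg-cong {p} {r} p≈r .coeff-≡ m
    rewrite coeff-neg p m | coeff-neg r m = cong ℤ.-_ (coeff-≡ p≈r m)

  +ᵖ-inverseʳ : ∀ p → p +ᵖ (-ᵖ p) ≈ᵖ 0ᵖ
  +ᵖ-inverseʳ p .coeff-≡ m rewrite coeff-+ p (-ᵖ p) m | coeff-neg p m = ℤ.+-inverseʳ (coeff p m)

  ·-cong : ∀ a {p r} → p ≈ᵖ r → a ·ᵖ p ≈ᵖ a ·ᵖ r
  ·-cong a {p} {r} p≈r .coeff-≡ m
    rewrite coeff-· a p m | coeff-· a r m = cong (a ℤ.*_) (coeff-≡ p≈r m)

  ·-distribˡ : ∀ a p r → a ·ᵖ (p +ᵖ r) ≈ᵖ a ·ᵖ p +ᵖ a ·ᵖ r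
  ·-distribˡ a p r .coeff-≡ m
    rewrite coeff-· a (p +ᵖ r) m | coeff-+ p r m | coeff-+ (a ·ᵖ p) (a ·ᵖ r) m
          | coeff-· a p m | coeff-· a r m = ℤ.*-distribˡ-+ a _ _

  ·-assoc : ∀ a b p → (a ℤ.* b) ·ᵖ p ≈ᵖ a ·ᵖ (b ·ᵖ p)
  ·-assoc a b p .coeff-≡ m
    rewrite coeff-· (a ℤ.* b) p m | coeff-· a (b ·ᵖ p) m | coeff-· b p m = ℤ.*-assoc a b _

  0·≈0 : ∀ p → 0ℤ ·ᵖ p ≈ᵖ 0ᵖ
  0·≈0 p .coeff-≡ m = coeff-· 0ℤ p m

  +ᵖ-leftComm : ∀ p r s → p +ᵖ (r +ᵖ s) ≈ᵖ r +ᵖ (p +ᵖ s)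
  +ᵖ-leftComm p r s =
    ≈-trans (≈-sym (+ᵖ-assoc p r s)) (≈-trans (+ᵖ-cong (+ᵖ-comm p r) ≈-refl) (+ᵖ-assoc r p s))

  +ᵖ-interchange : ∀ p r s t → (p +ᵖ r) +ᵖ (s +ᵖ t) ≈ᵖ (p +ᵖ s) +ᵖ (r +ᵖ t)
  +ᵖ-interchange p r s t = ≈-trans (+ᵖ-assoc p r _)
    (≈-trans (+ᵖ-cong (≈-refl {p}) (+ᵖ-leftComm r s t)) (≈-sym (+ᵖ-assoc p s _)))

  *ᵖ-congˡ : ∀ p {r r′} → r ≈ᵖ r′ → p *ᵖ r ≈ᵖ p *ᵖ r′
  *ᵖ-congˡ []      r≈r′ = ≈-refl
  *ᵖ-congˡ (a ∷ p) r≈r′ = +ᵖ-cong (·-cong a r≈r′) (∷-cong refl (*ᵖ-congˡ p r≈r′))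

  *ᵖ-zeroʳ : ∀ p → p *ᵖ 0ᵖ ≈ᵖ 0ᵖ
  *ᵖ-zeroʳ []      = ≈-refl
  *ᵖ-zeroʳ (a ∷ p) = 0∷-≈0 refl (*ᵖ-zeroʳ p)

  *ᵖ-∷ : ∀ p b r → p *ᵖ (b ∷ r) ≈ᵖ b ·ᵖ p +ᵖ (0ℤ ∷ p *ᵖ r)
  *ᵖ-∷ []      b r = ≈-sym (0∷-≈0 refl ≈-refl)
  *ᵖ-∷ (a ∷ p) b r = ∷-cong (cong (ℤ._+ 0ℤ) (ℤ.*-comm a b))
    (≈-trans (+ᵖ-cong (≈-refl {a ·ᵖ r}) (*ᵖ-∷ p b r)) (+ᵖ-leftComm (a ·ᵖ r) (b ·ᵖ p) _))

  *ᵖ-comm : ∀ p r → p *ᵖ r ≈ᵖ r *ᵖ p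
  *ᵖ-comm []      r = ≈-sym (*ᵖ-zeroʳ r)
  *ᵖ-comm (a ∷ p) r =
    ≈-trans (+ᵖ-cong (≈-refl {a ·ᵖ r}) (∷-cong refl (*ᵖ-comm p r))) (≈-sym (*ᵖ-∷ r a p))

  *ᵖ-cong : ∀ {p p′ r r′} → p ≈ᵖ p′ → r ≈ᵖ r′ → p *ᵖ r ≈ᵖ p′ *ᵖ r′
  *ᵖ-cong {p} {p′} {r} {r′} p≈p′ r≈r′ = ≈-trans (*ᵖ-congˡ p r≈r′)
    (≈-trans (*ᵖ-comm p r′) (≈-trans (*ᵖ-congˡ r′ p≈p′) (*ᵖ-comm r′ p′)))

  *ᵖ-distribˡ : ∀ p r s → p *ᵖ (r +ᵖ s) ≈ᵖ p *ᵖ r +ᵖ p *ᵖ s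
  *ᵖ-distribˡ []      r s = ≈-refl
  *ᵖ-distribˡ (a ∷ p) r s = ≈-trans (+ᵖ-cong (·-distribˡ a r s) (∷-cong refl (*ᵖ-distribˡ p r s)))
    (+ᵖ-interchange (a ·ᵖ r) (a ·ᵖ s) (0ℤ ∷ p *ᵖ r) (0ℤ ∷ p *ᵖ s))

  *ᵖ-distribʳ : ∀ s p r → (p +ᵖ r) *ᵖ s ≈ᵖ p *ᵖ s +ᵖ r *ᵖ s
  *ᵖ-distribʳ s p r = ≈-trans (*ᵖ-comm (p +ᵖ r) s)
    (≈-trans (*ᵖ-distribˡ s p r) (+ᵖ-cong (*ᵖ-comm s p) (*ᵖ-comm s r)))

  ·-*-assoc : ∀ a p r → (a ·ᵖ p) *ᵖ r ≈ᵖ a ·ᵖ (p *ᵖ r)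
  ·-*-assoc a []      r = ≈-refl
  ·-*-assoc a (b ∷ p) r =
    ≈-trans (+ᵖ-cong (·-assoc a b r) (∷-cong (sym (ℤ.*-zeroʳ a)) (·-*-assoc a p r)))
            (≈-sym (·-distribˡ a (b ·ᵖ r) (0ℤ ∷ p *ᵖ r)))

  0∷-* : ∀ p r → (0ℤ ∷ p) *ᵖ r ≈ᵖ 0ℤ ∷ p *ᵖ r
  0∷-* p r = +ᵖ-cong (0·≈0 r) ≈-refl

  *ᵖ-assoc : ∀ p r s → (p *ᵖ r) *ᵖ s ≈ᵖ p *ᵖ (r *ᵖ s)
  *ᵖ-assoc []      r s = ≈-refl
  *ᵖ-assoc (a ∷ p) r s = ≈-trans (*ᵖ-distribʳ s (a ·ᵖ r) (0ℤ ∷ p *ᵖ r))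
    (+ᵖ-cong (·-*-assoc a r s) (≈-trans (0∷-* (p *ᵖ r) s) (∷-cong refl (*ᵖ-assoc p r s))))

  *ᵖ-identityˡ : ∀ p → 1ᵖ *ᵖ p ≈ᵖ p
  *ᵖ-identityˡ p .coeff-≡ m rewrite coeff-+ (1ℤ ·ᵖ p) (0ℤ ∷ []) m | coeff-· 1ℤ p m = trans
    (cong₂ ℤ._+_ (ℤ.*-identityˡ (coeff p m)) (coeff-≡ (0∷-≈0 refl (≈-refl {[]})) m))
    (ℤ.+-identityʳ _)

  ℤ[q]-commutativeRing : CommutativeRing 0ℓ 0ℓ
  ℤ[q]-commutativeRing = record
    { Carrier = ℤ[q] ; _≈_ = _≈ᵖ_ ; _+_ = _+ᵖ_ ; _*_ = _*ᵖ_ ; -_ = -ᵖ_ ; 0# = 0ᵖ ; 1# = 1ᵖ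
    ; isCommutativeRing = record
      { isRing = record
        { +-isAbelianGroup = record
          { isGroup = record
            { isMonoid = record
              { isSemigroup = record
                { isMagma = record { isEquivalence = ≈ᵖ-isEquivalence ; ∙-cong = +ᵖ-cong }
                ; assoc   = +ᵖ-assoc
                }
              ; identity = (λ p → ≈-refl) , +ᵖ-identityʳ
              }
            ; inverse = (λ p → ≈-trans (+ᵖ-comm (-ᵖ p) p) (+ᵖ-inverseʳ p)) , +ᵖ-inverseʳ
            ; ⁻¹-cong = neg-cong
            }
          ; comm = +ᵖ-comm
          }
        ; *-cong     = *ᵖ-cong
        ; *-assoc    = *ᵖ-assoc
        ; *-identity = *ᵖ-identityˡ , λ p → ≈-trans (*ᵖ-comm p 1ᵖ) (*ᵖ-identityˡ p)
        ; distrib    = *ᵖ-distribˡ , *ᵖ-distribʳ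
        }
      ; *-comm = *ᵖ-comm
      }
    }

  _≈?_ : Decidable _≈ᵖ_
  p ≈? r = map′
    (λ p-r≈0 → coeffwise λ m → ℤ.i-j≡0⇒i≡j (coeff p m) (coeff r m)
      (trans (cong (λ z → coeff p m ℤ.+ z) (sym (coeff-neg r m)))
      (trans (sym (coeff-+ p (-ᵖ r) m)) (coeff-≡ p-r≈0 m))))
    (λ p≈r → ≈-trans (+ᵖ-cong p≈r ≈-refl) (+ᵖ-inverseʳ r))
    ((p +ᵖ (-ᵖ r)) ≈0?)

  open RingSolver (fromCommutativeRing ℤ[q]-commutativeRing) _≈?_
    public using (solve; _:=_; _:+_; _:*_; :-_; con)

  +ᵖ-cancelʳ : ∀ {p r} s → p +ᵖ s ≈ᵖ r +ᵖ s → p ≈ᵖ r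
  +ᵖ-cancelʳ {p} {r} s p+s≈r+s = ≈-trans (remove p)
    (≈-trans (+ᵖ-cong p+s≈r+s (≈-refl { -ᵖ s})) (≈-sym (remove r)))
    where
    remove : ∀ p → p ≈ᵖ (p +ᵖ s) +ᵖ (-ᵖ s)
    remove p = solve 2 (λ p s → p := (p :+ s) :+ (:- s)) ≈-refl p s

  -- p - r = a - b, with both sides moved so that no subtraction occurs.
  because : ∀ {a b p r} → a ≈ᵖ b → p +ᵖ b ≈ᵖ r +ᵖ a → p ≈ᵖ r
  because {a} {b} a≈b p+b≈r+a = +ᵖ-cancelʳ b (≈-trans p+b≈r+a (+ᵖ-cong ≈-refl a≈b))

  -- Powers of q and q-integers.

  qᵖ : ℤ[q]
  qᵖ = q^ 1

  q^-suc : ∀ a → q^ suc a ≈ᵖ qᵖ *ᵖ (q^ a)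
  q^-suc a = ≈-sym (≈-trans (0∷-* 1ᵖ (q^ a)) (∷-cong refl (*ᵖ-identityˡ (q^ a))))

  q^-+ : ∀ a b → q^ (a ℕ.+ b) ≈ᵖ (q^ a) *ᵖ (q^ b)
  q^-+ zero    b = ≈-sym (*ᵖ-identityˡ (q^ b))
  q^-+ (suc a) b = ≈-trans (∷-cong refl (q^-+ a b)) (≈-sym (0∷-* (q^ a) (q^ b)))

  []q-+ : ∀ a b → [ a ℕ.+ b ]q ≈ᵖ [ a ]q +ᵖ (q^ a) *ᵖ [ b ]q
  []q-+ zero    b = ≈-sym (*ᵖ-identityˡ [ b ]q)
  []q-+ (suc a) b = ≈-trans (∷-cong (sym (ℤ.+-identityʳ 1ℤ)) ([]q-+ a b))
    (+ᵖ-cong (≈-refl {1ℤ ∷ [ a ]q}) (≈-sym (0∷-* (q^ a) [ b ]q)))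

  q^-cancel : ∀ a {p r} → (q^ a) *ᵖ p ≈ᵖ (q^ a) *ᵖ r → p ≈ᵖ r
  q^-cancel zero    {p} {r} eq = ≈-trans (≈-sym (*ᵖ-identityˡ p)) (≈-trans eq (*ᵖ-identityˡ r))
  q^-cancel (suc a) {p} {r} eq = q^-cancel a (coeffwise λ m → coeff-≡ shifted (suc m))
    where
    shifted : 0ℤ ∷ ((q^ a) *ᵖ p) ≈ᵖ 0ℤ ∷ ((q^ a) *ᵖ r)
    shifted = ≈-trans (≈-sym (0∷-* (q^ a) p)) (≈-trans eq (0∷-* (q^ a) r))

  q^≉0 : ∀ a → q^ a ≉ᵖ 0ᵖ
  q^≉0 zero    = 1≉0
  q^≉0 (suc a) eq = q^≉0 a (coeffwise λ m → coeff-≡ eq (suc m))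

  -- Polynomials with nonnegative coefficients.

  NonNeg : ℤ[q] → Set
  NonNeg p = ∀ m → 0ℤ ℤ.≤ coeff p m

  record Positive (p : ℤ[q]) : Set where
    constructor positive
    field
      nonNegative : NonNeg p
      nonvanishing     : p ≉ᵖ 0ᵖ
  open Positive public

  NonNeg-≈ : ∀ {p r} → p ≈ᵖ r → NonNeg p → NonNeg r
  NonNeg-≈ p≈r p≥0 m = subst (0ℤ ℤ.≤_) (coeff-≡ p≈r m) (p≥0 m)

  NonNeg-q^ : ∀ a {p} → NonNeg p → NonNeg ((q^ a) *ᵖ p)
  NonNeg-q^ zero    {p} p≥0 = NonNeg-≈ (≈-sym (*ᵖ-identityˡ p)) p≥0
  NonNeg-q^ (suc a) {p} p≥0 = NonNeg-≈ (≈-sym (0∷-* (q^ a) p)) λ where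
    zero    → ℤ.≤-refl
    (suc m) → NonNeg-q^ a p≥0 m

  NonNeg-q^⁻¹ : ∀ a {p} → NonNeg ((q^ a) *ᵖ p) → NonNeg p
  NonNeg-q^⁻¹ zero    {p} qp≥0 = NonNeg-≈ (*ᵖ-identityˡ p) qp≥0
  NonNeg-q^⁻¹ (suc a) {p} qp≥0 = NonNeg-q^⁻¹ a λ m → NonNeg-≈ (0∷-* (q^ a) p) qp≥0 (suc m)

  NonNeg-+ : ∀ {p r} → NonNeg p → NonNeg r → NonNeg (p +ᵖ r)
  NonNeg-+ {p} {r} p≥0 r≥0 m =
    subst (0ℤ ℤ.≤_) (sym (coeff-+ p r m)) (ℤ.+-mono-≤ (p≥0 m) (r≥0 m))

  i+j≡0⇒i≡0 : ∀ {i j} → 0ℤ ℤ.≤ i → 0ℤ ℤ.≤ j → i ℤ.+ j ≡ 0ℤ → i ≡ 0ℤ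
  i+j≡0⇒i≡0 {i} {j} 0≤i 0≤j i+j≡0 = ℤ.≤-antisym
    (subst₂ ℤ._≤_ (ℤ.+-identityʳ i) i+j≡0 (ℤ.+-monoʳ-≤ i 0≤j)) 0≤i

  -- Nonvanishing alone is not inherited by sums; nonnegative coefficients rule out cancellation.
  -- This is why positivity is carried through the whole argument.
  Positive-+ : ∀ {p r} → Positive p → NonNeg r → Positive (p +ᵖ r)
  Positive-+ {p} {r} p>0 r≥0 = positive (NonNeg-+ {p} {r} (nonNegative p>0) r≥0) λ p+r≈0 →
    nonvanishing p>0 (coeffwise λ m → i+j≡0⇒i≡0 (nonNegative p>0 m) (r≥0 m)
      (trans (sym (coeff-+ p r m)) (coeff-≡ p+r≈0 m)))

  Positive-q^ : ∀ a {p} → Positive p → Positive ((q^ a) *ᵖ p)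
  Positive-q^ a p>0 = positive (NonNeg-q^ a (nonNegative p>0)) (*-≉0 (q^≉0 a) (nonvanishing p>0))

  Positive-q^⁻¹ : ∀ a {p r} → (q^ a) *ᵖ p ≈ᵖ r → Positive r → Positive p
  Positive-q^⁻¹ a {p} {r} qp≈r r>0 = positive
    (NonNeg-q^⁻¹ a (NonNeg-≈ (≈-sym qp≈r) (nonNegative r>0)))
    λ p≈0 → nonvanishing r>0
      (≈-trans (≈-sym qp≈r) (≈-trans (*ᵖ-congˡ (q^ a) p≈0) (*ᵖ-zeroʳ (q^ a))))

  -- Relations between the values of a solution along an edge.

  -- For a solution g of the recurrence and an edge xy with e cells below it, p of them at x
  -- and r at y; gx⁺ and gy⁻ stand for g(x+1) and g(y-1).
  record EdgeRel (e p r : ℕ) (gx gx⁺ gy⁻ gy : ℤ[q]) : Set where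
    constructor edgeRel
    field
      atLeft  : qᵖ *ᵖ [ p ]q *ᵖ gx +ᵖ (q^ e) *ᵖ gy ≈ᵖ (q^ p) *ᵖ gx⁺
      atRight : (q^ e) *ᵖ gy⁻ ≈ᵖ (q^ e) *ᵖ [ r ]q *ᵖ gy +ᵖ (q^ r) *ᵖ gx
  open EdgeRel public

  edgeRel-side : ∀ gx gy → EdgeRel 0 0 0 gx gy gx gy
  edgeRel-side gx gy = edgeRel
    (solve 2 (λ x y → con qᵖ :* con 0ᵖ :* x :+ con 1ᵖ :* y := con 1ᵖ :* y) ≈-refl gx gy)
    (solve 2 (λ x y → con 1ᵖ :* x := con 1ᵖ :* con 0ᵖ :* y :+ con 1ᵖ :* x) ≈-refl gx gy)

  module _ {e₁ p₁ r₁ e₂ p₂ r₂ gx gx⁺ gb⁻ gb gb⁺ gy⁻ gy}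
    (left : EdgeRel e₁ p₁ r₁ gx gx⁺ gb⁻ gb) (right : EdgeRel e₂ p₂ r₂ gb gb⁺ gy⁻ gy)
    where

    -- Multiply the recurrence at b by q^{e₁} and eliminate g(b-1) by the left relation and g(b+1)
    -- by the right one. The terms `[ r₁ ]q` and q `[ p₂ ]q` of the coefficient of g(b) cancel, and
    -- a common factor q^{r₁} remains to be removed.
    edgeRel-apex : gb⁻ ≈ᵖ [ suc (r₁ ℕ.+ p₂) ]q *ᵖ gb +ᵖ (-ᵖ (q^ (r₁ ℕ.+ p₂))) *ᵖ gb⁺ →
                   (q^ e₁) *ᵖ gb ≈ᵖ (q^ (e₁ ℕ.+ e₂)) *ᵖ gy +ᵖ gx
    edgeRel-apex step = q^-cancel r₁ (≈-trans (because
      (+ᵖ-cong (+ᵖ-cong (atRight left) (*ᵖ-congˡ ((q^ e₁) *ᵖ (q^ r₁)) (≈-sym (atLeft right))))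
               (*ᵖ-congˡ (q^ e₁) (≈-sym step′)))
      (solve 11 (λ gx gb⁻ gb gb⁺ gy E₁ E₂ R₁ P₂ [r₁] [p₂] →
         R₁ :* (E₁ :* gb) :+ ((E₁ :* [r₁] :* gb :+ R₁ :* gx)
           :+ (E₁ :* R₁) :* (con qᵖ :* [p₂] :* gb :+ E₂ :* gy) :+ E₁ :* gb⁻)
         := R₁ :* (E₁ :* E₂ :* gy :+ gx) :+ (E₁ :* gb⁻ :+ (E₁ :* R₁) :* (P₂ :* gb⁺)
           :+ E₁ :* (([r₁] :+ R₁ :* (con 1ᵖ :+ con qᵖ :* [p₂])) :* gb :+ (:- (R₁ :* P₂)) :* gb⁺)))
         ≈-refl gx gb⁻ gb gb⁺ gy (q^ e₁) (q^ e₂) (q^ r₁) (q^ p₂) [ r₁ ]q [ p₂ ]q))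
      (*ᵖ-congˡ (q^ r₁) (+ᵖ-cong (*ᵖ-cong (≈-sym (q^-+ e₁ e₂)) ≈-refl) ≈-refl)))
      where
      -- The q-integer is split into the cells at b to the left, the cell x b y itself (the summand
      -- 1), and the cells at b to the right.
      [c]≈ : [ suc (r₁ ℕ.+ p₂) ]q ≈ᵖ [ r₁ ]q +ᵖ (q^ r₁) *ᵖ (1ᵖ +ᵖ qᵖ *ᵖ [ p₂ ]q)
      [c]≈ = subst (λ a → [ a ]q ≈ᵖ [ r₁ ]q +ᵖ (q^ r₁) *ᵖ (1ᵖ +ᵖ qᵖ *ᵖ [ p₂ ]q)) (ℕ.+-suc r₁ p₂)
        (≈-trans ([]q-+ r₁ (suc p₂)) (+ᵖ-cong ≈-refl (*ᵖ-congˡ (q^ r₁) ([]q-+ 1 p₂))))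
      step′ : gb⁻ ≈ᵖ ([ r₁ ]q +ᵖ (q^ r₁) *ᵖ (1ᵖ +ᵖ qᵖ *ᵖ [ p₂ ]q)) *ᵖ gb
                     +ᵖ (-ᵖ ((q^ r₁) *ᵖ (q^ p₂))) *ᵖ gb⁺
      step′ = ≈-trans step (+ᵖ-cong (*ᵖ-cong [c]≈ ≈-refl) (*ᵖ-cong (neg-cong (q^-+ r₁ p₂)) ≈-refl))

    -- The apex equation eliminates g(b) from q times the left relation at x and from q^{1+e₁} times
    -- the right relation at y. The new cell adds one to each of the three counts.
    edgeRel-glue : (q^ e₁) *ᵖ gb ≈ᵖ (q^ (e₁ ℕ.+ e₂)) *ᵖ gy +ᵖ gx →
                   EdgeRel (suc (e₁ ℕ.+ e₂)) (suc p₁) (suc r₂) gx gx⁺ gy⁻ gy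
    edgeRel-glue apex = edgeRel
      (≈-trans (+ᵖ-cong (*ᵖ-cong (*ᵖ-congˡ qᵖ ([]q-+ 1 p₁)) ≈-refl)
                         (*ᵖ-cong (q^-suc (e₁ ℕ.+ e₂)) ≈-refl))
      (≈-trans (because (*ᵖ-congˡ qᵖ (+ᵖ-cong (atLeft left) (≈-sym apex)))
        (solve 8 (λ gx gx⁺ gb gy E₁ E P₁ [p₁] →
           (con qᵖ :* (con 1ᵖ :+ con qᵖ :* [p₁]) :* gx :+ con qᵖ :* E :* gy)
             :+ con qᵖ :* (P₁ :* gx⁺ :+ E₁ :* gb)
           := con qᵖ :* P₁ :* gx⁺
             :+ con qᵖ :* ((con qᵖ :* [p₁] :* gx :+ E₁ :* gb) :+ (E :* gy :+ gx)))
           ≈-refl gx gx⁺ gb gy (q^ e₁) (q^ (e₁ ℕ.+ e₂)) (q^ p₁) [ p₁ ]q))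
        (*ᵖ-cong (≈-sym (q^-suc p₁)) ≈-refl)))
      (≈-trans (*ᵖ-cong q^e≈ ≈-refl)
      (≈-trans (because
        (+ᵖ-cong (*ᵖ-congˡ (qᵖ *ᵖ (q^ e₁)) (atRight right))
                 (*ᵖ-congˡ (qᵖ *ᵖ (q^ r₂))
                   (≈-trans apex (+ᵖ-cong (*ᵖ-cong (q^-+ e₁ e₂) ≈-refl) ≈-refl))))
        (solve 8 (λ gx gb gy⁻ gy E₁ E₂ R₂ [r₂] →
           con qᵖ :* (E₁ :* E₂) :* gy⁻
             :+ (con qᵖ :* E₁ :* (E₂ :* [r₂] :* gy :+ R₂ :* gb)
                 :+ con qᵖ :* R₂ :* (E₁ :* E₂ :* gy :+ gx))
           := (con qᵖ :* (E₁ :* E₂) :* ([r₂] :+ R₂ :* con 1ᵖ) :* gy :+ con qᵖ :* R₂ :* gx)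
             :+ (con qᵖ :* E₁ :* (E₂ :* gy⁻) :+ con qᵖ :* R₂ :* (E₁ :* gb)))
           ≈-refl gx gb gy⁻ gy (q^ e₁) (q^ e₂) (q^ r₂) [ r₂ ]q))
        (+ᵖ-cong (*ᵖ-cong (*ᵖ-cong (≈-sym q^e≈) [r]≈) ≈-refl)
                 (*ᵖ-cong (≈-sym (q^-suc r₂)) ≈-refl))))
      where
      q^e≈ : q^ suc (e₁ ℕ.+ e₂) ≈ᵖ qᵖ *ᵖ ((q^ e₁) *ᵖ (q^ e₂))
      q^e≈ = ≈-trans (q^-suc (e₁ ℕ.+ e₂)) (*ᵖ-congˡ qᵖ (q^-+ e₁ e₂))
      [r]≈ : [ r₂ ]q +ᵖ (q^ r₂) *ᵖ 1ᵖ ≈ᵖ [ suc r₂ ]q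
      [r]≈ = subst (λ a → [ r₂ ]q +ᵖ (q^ r₂) *ᵖ 1ᵖ ≈ᵖ [ a ]q) (ℕ.+-comm r₂ 1) (≈-sym ([]q-+ r₂ 1))

  -- Continuants, matrix products and the unimodular rule.

  -- K is the continuant, and κ the continuant of all terms but the first.
  mutual
    K κ : List ℕ → ℤ[q]
    K []       = 1ᵖ
    K (c ∷ cs) = [ c ]q *ᵖ K cs +ᵖ (-ᵖ (q^ pred c)) *ᵖ κ cs
    κ []       = 0ᵖ
    κ (_ ∷ cs) = K cs

  1*+0*≈ : ∀ p r → 1ᵖ *ᵖ p +ᵖ 0ᵖ *ᵖ r ≈ᵖ p
  1*+0*≈ = solve 2 (λ p r → con 1ᵖ :* p :+ con 0ᵖ :* r := p) ≈-refl

  Mq-column₁ : ∀ cs → (a₁₁ (Mq cs) ≈ᵖ K cs) × (a₂₁ (Mq cs) ≈ᵖ κ cs)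
  Mq-column₁ []       = ≈-refl , ≈-refl
  Mq-column₁ (c ∷ cs) =
    let R≈ , S≈ = Mq-column₁ cs
    in +ᵖ-cong (*ᵖ-congˡ [ c ]q R≈) (*ᵖ-congˡ (-ᵖ (q^ pred c)) S≈) ,
       ≈-trans (1*+0*≈ _ (a₂₁ (Mq cs))) R≈

  -- The last factor sends the second basis vector to -q^{d-1} times the first, so the second column
  -- is that multiple of the first column of the product without d.
  Mq-column₂ : ∀ cs d → (a₁₂ (Mq (cs ∷ʳ d)) ≈ᵖ -ᵖ ((q^ pred d) *ᵖ K cs)) ×
                        (a₂₂ (Mq (cs ∷ʳ d)) ≈ᵖ -ᵖ ((q^ pred d) *ᵖ κ cs))
  Mq-column₂ [] d =
    solve 2 (λ [d] D → [d] :* con 0ᵖ :+ (:- D) :* con 1ᵖ := :- (D :* con 1ᵖ))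
      ≈-refl [ d ]q (q^ pred d) ,
    solve 1 (λ D → con 1ᵖ :* con 0ᵖ :+ con 0ᵖ :* con 1ᵖ := :- (D :* con 0ᵖ)) ≈-refl (q^ pred d)
  Mq-column₂ (c ∷ cs) d =
    let R≈ , S≈ = Mq-column₂ cs d
    in ≈-trans (+ᵖ-cong (*ᵖ-congˡ [ c ]q R≈) (*ᵖ-congˡ (-ᵖ (q^ pred c)) S≈))
         (solve 5 (λ D [c] C k κ → [c] :* (:- (D :* k)) :+ (:- C) :* (:- (D :* κ))
                                := :- (D :* ([c] :* k :+ (:- C) :* κ)))
            ≈-refl (q^ pred d) [ c ]q (q^ pred c) (K cs) (κ cs)) ,
       ≈-trans (1*+0*≈ _ (a₂₂ (Mq (cs ∷ʳ d)))) R≈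

  -- Z c k m is the frieze entry ζ_{k,k+m}.
  Z : (ℤ → ℕ) → ℤ → ℕ → ℤ[q]
  Z c k m = κ (run c k m)

  -- The left side is the Casorati determinant of two solutions of the same recurrence, so each
  -- further term c of the run multiplies it by q^{c-1}.
  unimodular : ∀ c k m →
    Z c k (1 ℕ.+ m) *ᵖ Z c (ℤ.suc k) (1 ℕ.+ m) +ᵖ (-ᵖ (Z c (ℤ.suc k) m *ᵖ Z c k (2 ℕ.+ m)))
    ≈ᵖ q^ sum (map pred (run c (ℤ.suc k) m))
  unimodular c k zero    =
    solve 1 (λ z → con 1ᵖ :* con 1ᵖ :+ (:- (con 0ᵖ :* z)) := con 1ᵖ) ≈-refl (Z c k 2)
  unimodular c k (suc m) = ≈-trans
    (solve 6 (λ [c] C A B D E →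
        ([c] :* A :+ (:- C) :* D) :* B :+ (:- (A :* ([c] :* B :+ (:- C) :* E)))
        := C :* (A :* E :+ (:- (D :* B))))
      ≈-refl [ c k′ ]q (q^ pred (c k′)) (Z c k′ (1 ℕ.+ m)) (Z c k′ (2 ℕ.+ m))
      (Z c (ℤ.suc k′) m) (Z c (ℤ.suc k′) (1 ℕ.+ m)))
    (≈-trans (*ᵖ-congˡ (q^ pred (c k′)) (unimodular c k′ m)) (≈-sym (q^-+ (pred (c k′)) _)))
    where k′ = ℤ.suc k

module Triangulations where

  open import Data.Nat.Base
  open import Data.Nat.Properties
  open +-*-Solver using (solve; _:=_; _:+_; con)

  -- Triangulations as binary trees, their vertex degrees and their rotation.

  -- The triangulations of the polygon with vertices x, x + 1, …, y and base edge xy.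
  data Tri : ℕ → ℕ → Set where
    side : ∀ {x} → Tri x (suc x)
    glue : ∀ {x b y} → Tri x b → Tri b y → Tri x y

  Tri⇒< : ∀ {x y} → Tri x y → x < y
  Tri⇒< side       = ≤-refl
  Tri⇒< (glue l r) = <-trans (Tri⇒< l) (Tri⇒< r)

  Triangle : Set
  Triangle = ℕ × ℕ × ℕ

  triangles : ∀ {x y} → Tri x y → List Triangle
  triangles side = []
  triangles (glue {x} {b} {y} l r) = (x , b , y) ∷ triangles l ++ triangles r

  _touches_ : Triangle → ℕ → Set
  (x , b , y) touches v = v ≡ x ⊎ v ≡ b ⊎ v ≡ y

  touches? : ∀ v t → Dec (t touches v)
  touches? v (x , b , y) = (v ≟ x) ⊎-dec ((v ≟ b) ⊎-dec (v ≟ y))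

  deg : ∀ {x y} → Tri x y → ℕ → ℕ
  deg t v = length (filter (touches? v) (triangles t))

  deg-halves : ∀ {x b y} (l : Tri x b) (r : Tri b y) v →
    length (filter (touches? v) (triangles l ++ triangles r)) ≡ deg l v + deg r v
  deg-halves l r v = trans (cong length (filter-++ (touches? v) (triangles l) (triangles r)))
                           (length-++ (filter (touches? v) (triangles l)))

  deg-on : ∀ {x b y v} (l : Tri x b) (r : Tri b y) → (x , b , y) touches v →
           deg (glue l r) v ≡ suc (deg l v + deg r v)
  deg-on {v = v} l r on = trans (cong length (filter-accept (touches? v) on))
                                (cong suc (deg-halves l r v))

  deg-off : ∀ {x b y v} (l : Tri x b) (r : Tri b y) → ¬ (x , b , y) touches v →
            deg (glue l r) v ≡ deg l v + deg r v
  deg-off {v = v} l r off = trans (cong length (filter-reject (touches? v) off)) (deg-halves l r v)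

  deg-below : ∀ {x y v} (t : Tri x y) → v < x → deg t v ≡ 0
  deg-below side       v<x = refl
  deg-below (glue l r) v<x = trans
    (deg-off l r λ where
      (inj₁ v≡x)        → <⇒≢ v<x v≡x
      (inj₂ (inj₁ v≡b)) → <⇒≢ (<-trans v<x (Tri⇒< l)) v≡b
      (inj₂ (inj₂ v≡y)) → <⇒≢ (<-trans v<x (Tri⇒< (glue l r))) v≡y)
    (cong₂ _+_ (deg-below l v<x) (deg-below r (<-trans v<x (Tri⇒< l))))

  deg-above : ∀ {x y v} (t : Tri x y) → y < v → deg t v ≡ 0
  deg-above side       y<v = refl
  deg-above (glue l r) y<v = trans
    (deg-off l r λ where
      (inj₁ v≡x)        → >⇒≢ (<-trans (Tri⇒< (glue l r)) y<v) v≡x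
      (inj₂ (inj₁ v≡b)) → >⇒≢ (<-trans (Tri⇒< r) y<v) v≡b
      (inj₂ (inj₂ v≡y)) → >⇒≢ y<v v≡y)
    (cong₂ _+_ (deg-above l (<-trans (Tri⇒< r) y<v)) (deg-above r y<v))

  module _ {x b y} (l : Tri x b) (r : Tri b y) where

    deg-glue-first : deg (glue l r) x ≡ suc (deg l x)
    deg-glue-first = trans (deg-on l r (inj₁ refl))
      (cong suc (trans (cong (deg l x +_) (deg-below r (Tri⇒< l))) (+-identityʳ _)))

    deg-glue-last : deg (glue l r) y ≡ suc (deg r y)
    deg-glue-last = trans (deg-on l r (inj₂ (inj₂ refl)))
      (cong (λ d → suc (d + deg r y)) (deg-above l (Tri⇒< r)))

    deg-glue-apex : deg (glue l r) b ≡ suc (deg l b + deg r b)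
    deg-glue-apex = deg-on l r (inj₂ (inj₁ refl))

    deg-glue-left : ∀ {v} → x < v → v < b → deg (glue l r) v ≡ deg l v
    deg-glue-left {v} x<v v<b = trans
      (deg-off l r λ where
        (inj₁ v≡x)        → >⇒≢ x<v v≡x
        (inj₂ (inj₁ v≡b)) → <⇒≢ v<b v≡b
        (inj₂ (inj₂ v≡y)) → <⇒≢ (<-trans v<b (Tri⇒< r)) v≡y)
      (trans (cong (deg l v +_) (deg-below r v<b)) (+-identityʳ _))

    deg-glue-right : ∀ {v} → b < v → v < y → deg (glue l r) v ≡ deg r v
    deg-glue-right {v} b<v v<y = trans
      (deg-off l r λ where
        (inj₁ v≡x)        → >⇒≢ (<-trans (Tri⇒< l) b<v) v≡x
        (inj₂ (inj₁ v≡b)) → >⇒≢ b<v v≡b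
        (inj₂ (inj₂ v≡y)) → <⇒≢ v<y v≡y)
      (cong (_+ deg r v) (deg-above l b<v))

  -- Read z as another name of x: the polygon on x, …, y glued to the one on y, …, z
  -- along the edge between y and x = z.
  rotate : ∀ {x y z} → Tri x y → Tri y z → Tri (suc x) z
  rotate side       s = s
  -- The cell x b y becomes b y z under the new name of x, so it now sits to the right, on top of
  -- `r` and `s`.
  rotate (glue l r) s = rotate l (glue r s)

  -- Only the cells at x change, and each merely exchanges x for z. The strict bounds on v exclude
  -- exactly these two names.
  deg-rotate : ∀ {x y z v} (t : Tri x y) (s : Tri y z) → x < v → v < z →
               deg (rotate t s) v ≡ deg t v + deg s v
  deg-rotate side s x<v v<z = refl
  deg-rotate {x} {y} {z} {v} (glue {b = b} l r) s x<v v<z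
    with deg-rotate l (glue r s) x<v v<z | touches? v (x , b , y)
  ... | eq | yes on = begin
    deg (rotate l (glue r s)) v              ≡⟨ eq ⟩
    deg l v + deg (glue r s) v               ≡⟨ cong (deg l v +_) (deg-on r s (shift on)) ⟩
    deg l v + suc (deg r v + deg s v)        ≡⟨ +-suc (deg l v) _ ⟩
    suc (deg l v + (deg r v + deg s v))      ≡⟨ cong suc (+-assoc (deg l v) _ _) ⟨
    suc (deg l v + deg r v + deg s v)        ≡⟨ cong (_+ deg s v) (deg-on l r on) ⟨
    deg (glue l r) v + deg s v               ∎
    where
    open ≡-Reasoning
    shift : (x , b , y) touches v → (b , y , z) touches v
    shift (inj₁ v≡x)        = ⊥-elim (>⇒≢ x<v v≡x)
    shift (inj₂ (inj₁ v≡b)) = inj₁ v≡b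
    shift (inj₂ (inj₂ v≡y)) = inj₂ (inj₁ v≡y)
  ... | eq | no off = begin
    deg (rotate l (glue r s)) v        ≡⟨ eq ⟩
    deg l v + deg (glue r s) v         ≡⟨ cong (deg l v +_) (deg-off r s (off ∘ shift)) ⟩
    deg l v + (deg r v + deg s v)      ≡⟨ +-assoc (deg l v) _ _ ⟨
    deg l v + deg r v + deg s v        ≡⟨ cong (_+ deg s v) (deg-off l r off) ⟨
    deg (glue l r) v + deg s v         ∎
    where
    open ≡-Reasoning
    shift : (b , y , z) touches v → (x , b , y) touches v
    shift (inj₁ v≡b)        = inj₂ (inj₁ v≡b)
    shift (inj₂ (inj₁ v≡y)) = inj₂ (inj₂ v≡y)
    shift (inj₂ (inj₂ v≡z)) = ⊥-elim (<⇒≢ v<z v≡z)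

  deg-rotate-last : ∀ {x y z} (t : Tri x y) (s : Tri y z) →
                    deg (rotate t s) z ≡ deg t x + deg s z
  deg-rotate-last side s = refl
  deg-rotate-last {x} {y} {z} (glue l r) s = begin
    deg (rotate l (glue r s)) z    ≡⟨ deg-rotate-last l (glue r s) ⟩
    deg l x + deg (glue r s) z     ≡⟨ cong (deg l x +_) (deg-glue-last r s) ⟩
    deg l x + suc (deg s z)        ≡⟨ +-suc (deg l x) _ ⟩
    suc (deg l x) + deg s z        ≡⟨ cong (_+ deg s z) (deg-glue-first l r) ⟨
    deg (glue l r) x + deg s z     ∎
    where open ≡-Reasoning

  InSpan : ℕ → ℕ → Triangle → Set
  InSpan x y (a , b , c) = x ≤ a × (a < b × b < c) × c ≤ y

  triangles-span : ∀ {x y} (t : Tri x y) → All (InSpan x y) (triangles t)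
  triangles-span side       = []
  triangles-span (glue l r) = (≤-refl , (Tri⇒< l , Tri⇒< r) , ≤-refl) ∷ All.++⁺
    (All.map (λ (x≤a , abc , c≤b) → x≤a , abc , ≤-trans c≤b (<⇒≤ (Tri⇒< r))) (triangles-span l))
    (All.map (λ (b≤a , abc , c≤y) → ≤-trans (<⇒≤ (Tri⇒< l)) b≤a , abc , c≤y) (triangles-span r))

  triangles-unique : ∀ {x y} (t : Tri x y) → Unique (triangles t)
  triangles-unique side = []
  triangles-unique (glue l r) =
    All.++⁺ (All.map (λ where (_ , _ , y≤b) refl → <⇒≱ (Tri⇒< r) y≤b) (triangles-span l))
            (All.map (λ where (b≤x , _) refl → <⇒≱ (Tri⇒< l) b≤x) (triangles-span r))
    ∷ Unique.++⁺ (triangles-unique l) (triangles-unique r) λ (∈l , ∈r) →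
        let (_ , (a<b , b<c) , c≤) = All.lookup (triangles-span l) ∈l
            (≤a , _) = All.lookup (triangles-span r) ∈r
        in <⇒≱ (<-trans a<b b<c) (≤-trans c≤ ≤a)

  -- Counting lemmas, and trees from maximal sets of non-crossing chords.

  length-filter-∪ : ∀ {A : Set} {P Q R : A → Set}
    (P? : ∀ a → Dec (P a)) (Q? : ∀ a → Dec (Q a)) (R? : ∀ a → Dec (R a)) xs →
    (∀ {a} → a ∈ xs → P a → Q a ⊎ R a) →
    length (filter P? xs) ≤ length (filter Q? xs) + length (filter R? xs)
  length-filter-∪ P? Q? R? []       P⇒ = z≤n
  length-filter-∪ P? Q? R? (a ∷ xs) P⇒
    with length-filter-∪ P? Q? R? xs (P⇒ ∘ there) | P? a | Q? a | R? a
  ... | ih | no _  | no _  | no _  = ih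
  ... | ih | no _  | no _  | yes _ = ≤-trans ih (+-monoʳ-≤ (length (filter Q? xs)) (n≤1+n _))
  ... | ih | no _  | yes _ | no _  = m≤n⇒m≤1+n ih
  ... | ih | no _  | yes _ | yes _ = m≤n⇒m≤1+n (≤-trans ih (+-monoʳ-≤ (length (filter Q? xs)) (n≤1+n _)))
  ... | ih | yes p | no ¬q | no ¬r = ⊥-elim ([ ¬q , ¬r ]′ (P⇒ (here refl) p))
  ... | ih | yes _ | no _  | yes _ = ≤-trans (s≤s ih) (≤-reflexive (sym (+-suc _ _)))
  ... | ih | yes _ | yes _ | no _  = s≤s ih
  ... | ih | yes _ | yes _ | yes _ = s≤s (≤-trans ih (+-monoʳ-≤ (length (filter Q? xs)) (n≤1+n _)))

  length-filter-≡≤1 : ∀ {A : Set} (_≟ᴬ_ : ∀ (a b : A) → Dec (a ≡ b)) d {xs} → Unique xs →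
                      length (filter (_≟ᴬ d) xs) ≤ 1
  length-filter-≡≤1 _≟ᴬ_ d []                 = z≤n
  length-filter-≡≤1 _≟ᴬ_ d {a ∷ xs} (a∉ ∷ !xs) with a ≟ᴬ d
  ... | no  _    = length-filter-≡≤1 _≟ᴬ_ d !xs
  ... | yes refl = s≤s (≤-reflexive (cong length
                     (filter-none (_≟ᴬ d) (All.map (λ d≢ ≡d → d≢ (sym ≡d)) a∉))))

  1≤length-filter⇒∈ : ∀ {A : Set} (_≟ᴬ_ : ∀ (a b : A) → Dec (a ≡ b)) d xs →
                      1 ≤ length (filter (_≟ᴬ d) xs) → d ∈ xs
  1≤length-filter⇒∈ _≟ᴬ_ d (a ∷ xs) 1≤ with a ≟ᴬ d
  ... | yes refl = here refl
  ... | no  _    = there (1≤length-filter⇒∈ _≟ᴬ_ d xs 1≤)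

  ≤-tight : ∀ {a b c a′ b′ c′} → a ≤ a′ → b ≤ b′ → c ≤ c′ → a′ + (b′ + c′) ≤ a + (b + c) →
            a′ ≤ a × b′ ≤ b × c′ ≤ c
  ≤-tight {a} {b} {c} {a′} {b′} {c′} a≤ b≤ c≤ sum≤ =
      +-cancelʳ-≤ (b′ + c′) a′ a (≤-trans sum≤ (+-monoʳ-≤ a (+-mono-≤ b≤ c≤)))
    , +-cancelʳ-≤ c′ b′ b (≤-trans bc≤ (+-monoʳ-≤ b c≤))
    , +-cancelˡ-≤ b′ c′ c (≤-trans bc≤ (+-monoˡ-≤ c b≤))
    where
    bc≤ : b′ + c′ ≤ b + c
    bc≤ = +-cancelˡ-≤ a′ _ _ (≤-trans sum≤ (+-monoˡ-≤ (b + c) a≤))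

  Chord : Set
  Chord = ℕ × ℕ

  _≟ᶜ_ : (d e : Chord) → Dec (d ≡ e)
  _≟ᶜ_ = ≡-dec _≟_ _≟_

  Within : ℕ → ℕ → Chord → Set
  Within x y (a , c) = x ≤ a × c ≤ y

  within? : ∀ x y d → Dec (Within x y d)
  within? x y (a , c) = (x ≤? a) ×-dec (c ≤? y)

  module NonCrossingChords (D : List Chord) (D-unique : Unique D)
    (D-wide : ∀ {x y} → (x , y) ∈ D → 2 + x ≤ y)
    (D-nonCrossing : ∀ {x y x′ y′} → (x , y) ∈ D → (x′ , y′) ∈ D → x < x′ → x′ < y → y < y′ → ⊥)
    where

    open DecMembership _≟ᶜ_ using (_∈?_)

    E : ℕ → ℕ → Set
    E x y = y ≡ suc x ⊎ (x , y) ∈ D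

    IsCell : Triangle → Set
    IsCell (a , b , c) = (a < b × b < c) × E a b × E b c × E a c

    E-nonCrossing : ∀ {x y x′ y′} → E x y → E x′ y′ → x < x′ → x′ < y → y < y′ → ⊥
    E-nonCrossing (inj₁ refl) _           x<x′ x′<y y<y′ = <⇒≱ x′<y x<x′
    E-nonCrossing (inj₂ _)    (inj₁ refl) x<x′ x′<y y<y′ = <⇒≱ y<y′ x′<y
    E-nonCrossing (inj₂ ∈D)   (inj₂ ∈D′)  x<x′ x′<y y<y′ = D-nonCrossing ∈D ∈D′ x<x′ x′<y y<y′

    #within : ℕ → ℕ → ℕ
    #within x y = length (filter (within? x y) D)

    -- Finds the apex of the cell below a base from x to y + 1: the farthest neighbour of x other
    -- than the far end of the base. The search therefore stops at y.
    lastNeighbour : ∀ x y → x < y → ∃[ b ] x < b × b ≤ y × E x b ×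
                    (∀ {c} → (x , c) ∈ D → c ≤ y → c ≤ b)
    lastNeighbour x (suc y) (s≤s x≤y) with m≤n⇒m<n∨m≡n x≤y | (x , suc y) ∈? D
    ... | inj₂ refl | _      = suc x , ≤-refl , ≤-refl , inj₁ refl , λ _ c≤ → c≤
    ... | inj₁ x<y  | yes ∈D = suc y , s≤s x≤y , ≤-refl , inj₂ ∈D , λ _ c≤ → c≤
    ... | inj₁ x<y  | no ∉D  =
      let b , x<b , b≤y , Exb , last = lastNeighbour x y x<y
      in b , x<b , m≤n⇒m≤1+n b≤y , Exb , λ ∈D c≤ →
        last ∈D (s≤s⁻¹ (≤∧≢⇒< c≤ λ where refl → ∉D ∈D))

    -- A chord passing over b either starts to the right of x and crosses the edge from x to b, or
    -- starts at x, where the maximality of b leaves only the base.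
    split : ∀ {x y b} → E x b → x < b → (∀ {c} → (x , c) ∈ D → c < y → c ≤ b) →
            ∀ {d} → d ∈ D → Within x y d → d ≡ (x , y) ⊎ (Within x b d ⊎ Within b y d)
    split {x} {y} {b} Exb x<b last {a , c} ∈D (x≤a , c≤y) with c ≤? b | b ≤? a
    ... | yes c≤b | _       = inj₂ (inj₁ (x≤a , c≤b))
    ... | no  _   | yes b≤a = inj₂ (inj₂ (b≤a , c≤y))
    ... | no  c≰b | no  b≰a with m≤n⇒m<n∨m≡n x≤a | m≤n⇒m<n∨m≡n c≤y
    ...   | inj₁ x<a  | _         = ⊥-elim (E-nonCrossing Exb (inj₂ ∈D) x<a (≰⇒> b≰a) (≰⇒> c≰b))
    ...   | inj₂ refl | inj₁ c<y  = ⊥-elim (c≰b (last ∈D c<y))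
    ...   | inj₂ refl | inj₂ refl = inj₁ refl

    #within-side : ∀ x → #within x (suc x) ≡ 0
    #within-side x = cong length (filter-none (within? x (suc x))
      (All.tabulate λ {d} ∈D (x≤a , c≤1+x) →
        <⇒≱ (D-wide {proj₁ d} ∈D) (≤-trans c≤1+x (s≤s x≤a))))

    #≡ : Chord → ℕ
    #≡ d = length (filter (_≟ᶜ d) D)

    #within-split : ∀ {x y b} → E x b → x < b → (∀ {c} → (x , c) ∈ D → c < y → c ≤ b) →
                    #within x y ≤ #≡ (x , y) + (#within x b + #within b y)
    #within-split {x} {y} {b} Exb x<b last = ≤-trans
      (length-filter-∪ (within? x y) (_≟ᶜ (x , y)) either? D (split Exb x<b last))
      (+-monoʳ-≤ (#≡ (x , y)) (length-filter-∪ either? (within? x b) (within? b y) D λ _ w → w))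
      where
      either? : ∀ d → Dec (Within x b d ⊎ Within b y d)
      either? d = within? x b d ⊎-dec within? b y d

    rightGap : ∀ {gap x b y} → y ≤ suc gap + x → x < b → y ≤ gap + b
    rightGap {gap} {x} y≤ x<b =
      ≤-trans y≤ (≤-trans (≤-reflexive (sym (+-suc gap x))) (+-monoʳ-≤ gap x<b))

    -- With apex b, the base contributes at most 1 and the halves at most b - x - 1 and y - b - 1 by
    -- induction, which add up to y - x - 1. The bound `gap` on the width serves as the induction
    -- measure.
    #within-bound : ∀ gap {x y} → x < y → y ≤ gap + x → #within x y + suc x ≤ y
    #within-bound zero      x<y y≤x = ⊥-elim (<⇒≱ x<y y≤x)
    #within-bound (suc gap) {x} {suc y} (s≤s x≤y) y≤ with m≤n⇒m<n∨m≡n x≤y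
    ... | inj₂ refl = ≤-reflexive (cong (_+ suc x) (#within-side x))
    ... | inj₁ x<y with b , x<b , b≤y , Exb , last ← lastNeighbour x y x<y = begin
      #within x (suc y) + suc x
        ≤⟨ +-monoˡ-≤ (suc x) (#within-split Exb x<b λ ∈D c<y → last ∈D (s≤s⁻¹ c<y)) ⟩
      #≡ (x , suc y) + (#within x b + #within b (suc y)) + suc x
        ≤⟨ +-monoˡ-≤ (suc x) (+-monoˡ-≤ (#within x b + #within b (suc y))
             (length-filter-≡≤1 _≟ᶜ_ (x , suc y) D-unique)) ⟩
      1 + (#within x b + #within b (suc y)) + suc x
        ≡⟨ solve 3 (λ m n k → con 1 :+ (m :+ n) :+ k := n :+ (con 1 :+ (m :+ k))) refl
             (#within x b) (#within b (suc y)) (suc x) ⟩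
      #within b (suc y) + suc (#within x b + suc x)
        ≤⟨ +-monoʳ-≤ (#within b (suc y)) (s≤s (#within-bound gap x<b (≤-trans b≤y (s≤s⁻¹ y≤)))) ⟩
      #within b (suc y) + suc b
        ≤⟨ #within-bound gap (s≤s b≤y) (rightGap y≤ x<b) ⟩
      suc y ∎
      where open ≤-Reasoning

    -- #within x y attains its upper bound y - x - 1.
    Full : ℕ → ℕ → Set
    Full x y = y ≤ #within x y + suc x

    -- Equality in the counting bound forces equality in each of its three summands: the base is one
    -- of the chords, and both halves are full again. The edge from b to the right end is then the
    -- base found by the second recursive call.
    triangulate : ∀ gap {x y} → x < y → y ≤ gap + x → Full x y →
                  E x y × ∃[ t ] All IsCell (triangles {x} {y} t)
    triangulate zero      x<y y≤x full = ⊥-elim (<⇒≱ x<y y≤x)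
    triangulate (suc gap) {x} {suc y} (s≤s x≤y) y≤ full with m≤n⇒m<n∨m≡n x≤y
    ... | inj₂ refl = inj₁ refl , side , []
    ... | inj₁ x<y with b , x<b , b≤y , Exb , last ← lastNeighbour x y x<y =
      let lgap = ≤-trans b≤y (s≤s⁻¹ y≤)
          rgap = rightGap y≤ x<b
          one , lfull , rfull = ≤-tight (length-filter-≡≤1 _≟ᶜ_ (x , suc y) D-unique)
            (#within-bound gap x<b lgap) (#within-bound gap (s≤s b≤y) rgap) (begin
              1 + (b + suc y)
                ≡⟨ +-suc b (suc y) ⟨
              b + suc (suc y)
                ≤⟨ +-monoʳ-≤ b (s≤s full) ⟩
              b + suc (#within x (suc y) + suc x)
                ≤⟨ +-monoʳ-≤ b (s≤s (+-monoˡ-≤ (suc x)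
                     (#within-split Exb x<b λ ∈D c<y → last ∈D (s≤s⁻¹ c<y)))) ⟩
              b + suc (#≡ (x , suc y) + (#within x b + #within b (suc y)) + suc x)
                ≡⟨ solve 5 (λ b e m n k → b :+ (con 1 :+ (e :+ (m :+ n) :+ k))
                                       := e :+ (m :+ k :+ (n :+ (con 1 :+ b)))) refl
                     b (#≡ (x , suc y)) (#within x b) (#within b (suc y)) (suc x) ⟩
              #≡ (x , suc y) + (#within x b + suc x + (#within b (suc y) + suc b)) ∎)
          Exy = inj₂ (1≤length-filter⇒∈ _≟ᶜ_ (x , suc y) D one)
          _ , l , l-cells = triangulate gap x<b lgap lfull
          Eby , r , r-cells = triangulate gap (s≤s b≤y) rgap rfull
      in Exy , glue l r , ((x<b , s≤s b≤y) , Exb , Eby , Exy) ∷ All.++⁺ l-cells r-cells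
      where open ≤-Reasoning

    -- A cell that lies in neither half has its long edge passing over m. That edge crosses an edge
    -- of the root cell unless it is the base itself; then an apex other than m makes one of the two
    -- short edges cross an edge of the root cell.
    triangles-complete : ∀ {x y} (t : Tri x y) → All IsCell (triangles t) →
      ∀ {T} → IsCell T → InSpan x y T → T ∈ triangles t
    triangles-complete side _ _ (x≤a , (a<b , b<c) , c≤1+x) =
      ⊥-elim (<⇒≱ (≤-trans (s≤s a<b) b<c) (≤-trans c≤1+x (s≤s x≤a)))
    triangles-complete {x} {y} (glue {b = m} l r) ((_ , Exm , Emy , _) ∷ cells)
      {a , b , c} cell@(_ , Eab , Ebc , Eac) (x≤a , (a<b , b<c) , c≤y)
      with c ≤? m | m ≤? a
    ... | yes c≤m | _       = there (∈-++⁺ˡ (triangles-complete l (All.++⁻ˡ _ cells) cell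
                                (x≤a , (a<b , b<c) , c≤m)))
    ... | no _    | yes m≤a = there (∈-++⁺ʳ _ (triangles-complete r (All.++⁻ʳ (triangles l) cells) cell
                                (m≤a , (a<b , b<c) , c≤y)))
    ... | no c≰m  | no m≰a with m≤n⇒m<n∨m≡n x≤a | m≤n⇒m<n∨m≡n c≤y | <-cmp b m
    ...   | inj₁ x<a  | _         | _             = ⊥-elim (E-nonCrossing Exm Eac x<a (≰⇒> m≰a) (≰⇒> c≰m))
    ...   | inj₂ refl | inj₁ c<y  | _             = ⊥-elim (E-nonCrossing Eac Emy (≰⇒> m≰a) (≰⇒> c≰m) c<y)
    ...   | inj₂ refl | inj₂ refl | tri< b<m _ _  = ⊥-elim (E-nonCrossing Exm Ebc a<b b<m (≰⇒> c≰m))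
    ...   | inj₂ refl | inj₂ refl | tri> _ _ m<b  = ⊥-elim (E-nonCrossing Eab Emy (≰⇒> m≰a) m<b b<c)
    ...   | inj₂ refl | inj₂ refl | tri≈ _ refl _ = here refl

module Quiddities where

  open import Data.Integer.Base using (+_)
  open import Data.Nat.Base
  open import Data.Nat.Properties
  open AbelianGroup ℤ.+-0-abelianGroup using (∙-cancelʳ)
  open Triangulations

  -- From the given triangulation to trees whose degrees are the quiddity.

  length-filter-map : ∀ {A B : Set} {P : A → Set} {Q : B → Set}
    (P? : ∀ a → Dec (P a)) (Q? : ∀ b → Dec (Q b)) (f : A → B) →
    (∀ {a} → P a → Q (f a)) → (∀ {a} → Q (f a) → P a) → ∀ xs →
    length (filter P? xs) ≡ length (filter Q? (map f xs))
  length-filter-map P? Q? f P⇒Q Q⇒P [] = refl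
  length-filter-map P? Q? f P⇒Q Q⇒P (a ∷ xs) with P? a | Q? (f a)
  ... | yes p | yes _ = cong suc (length-filter-map P? Q? f P⇒Q Q⇒P xs)
  ... | yes p | no ¬q = ⊥-elim (¬q (P⇒Q p))
  ... | no ¬p | yes q = ⊥-elim (¬p (Q⇒P q))
  ... | no ¬p | no _  = length-filter-map P? Q? f P⇒Q Q⇒P xs

  quotient-≮ : ∀ {n r q r′ q′} → r < n → q ℤ.< q′ → + r ℤ.+ q ℤ.* + n ≢ + r′ ℤ.+ q′ ℤ.* + n
  quotient-≮ {n} {r} {q} {r′} {q′} r<n q<q′ eq = ℤ.<-irrefl eq (begin-strict
    + r ℤ.+ q ℤ.* + n    <⟨ ℤ.+-monoˡ-< (q ℤ.* + n) (ℤ.+<+ r<n) ⟩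
    + n ℤ.+ q ℤ.* + n    ≡⟨ ℤ.suc-* q (+ n) ⟨
    ℤ.suc q ℤ.* + n      ≤⟨ ℤ.*-monoʳ-≤-nonNeg (+ n) (ℤ.i<j⇒suc[i]≤j q<q′) ⟩
    q′ ℤ.* + n           ≤⟨ ℤ.i≤j+i _ (+ r′) ⟩
    + r′ ℤ.+ q′ ℤ.* + n  ∎)
    where open ℤ.≤-Reasoning

  %ℕ-unique : ∀ {n} .{{_ : NonZero n}} u r q → u ≡ + r ℤ.+ q ℤ.* + n → r < n → u %ℕ n ≡ r
  %ℕ-unique {n} u r q u≡ r<n with ℤ.<-cmp q (u /ℕ n) | trans (sym u≡) (a≡a%ℕn+[a/ℕn]*n u n)
  ... | tri≈ _ refl _  | eq = sym (ℤ.+-injective (∙-cancelʳ (q ℤ.* + n) (+ r) (+ (u %ℕ n)) eq))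
  ... | tri< q<u/n _ _ | eq = ⊥-elim (quotient-≮ {n} {r} {q} {u %ℕ n} r<n q<u/n eq)
  ... | tri> _ _ q>u/n | eq =
    ⊥-elim (quotient-≮ {n} {u %ℕ n} {u /ℕ n} {r} (n%ℕd<d u n) q>u/n (sym eq))

  module _ {k : ℕ} (T : Triangulation (3 + k)) where
    private n = 3 + k

    chord : Segment n → Chord
    chord (x , y) = toℕ x , toℕ y

    chord-injective : ∀ {d e} → chord d ≡ chord e → d ≡ e
    chord-injective {x , y} {x′ , y′} eq =
      cong₂ _,_ (toℕ-injective (cong proj₁ eq)) (toℕ-injective (cong proj₂ eq))

    corners : Triple T → Triangle
    corners (x , y , z) = toℕ x , toℕ y , toℕ z

    corners-injective : ∀ {s t} → corners s ≡ corners t → s ≡ t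
    corners-injective {x , _} {x′ , _} eq =
      cong₂ _,_ (toℕ-injective (cong proj₁ eq)) (chord-injective (cong proj₂ eq))

    -- The side from 0 to n - 1 is added as a chord with all cells below it.
    chords : List Chord
    chords = (0 , 2 + k) ∷ map chord (diagonals T)

    chords-split : ∀ {x y} → (x , y) ∈ chords → (x ≡ 0 × y ≡ 2 + k) ⊎
                   (∃[ u ] ∃[ v ] (u , v) ∈ diagonals T × x ≡ toℕ u × y ≡ toℕ v)
    chords-split (here refl) = inj₁ (refl , refl)
    chords-split (there ∈)   with (u , v) , ∈d , refl ← ∈-map⁻ chord ∈ =
      inj₂ (u , v , ∈d , refl , refl)

    chords-unique : Unique chords
    chords-unique = All.tabulate new ∷ Unique.map⁺ chord-injective (distinct T)
      where
      new : ∀ {d} → d ∈ map chord (diagonals T) → (0 , 2 + k) ≢ d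
      new ∈ refl with (u , v) , ∈d , eq ← ∈-map⁻ chord ∈ =
        proj₂ (isDiagonal T ∈d) (inj₂ (sym (cong proj₁ eq) , cong suc (sym (cong proj₂ eq))))

    chords-bounded : ∀ {x y} → (x , y) ∈ chords → y ≤ 2 + k
    chords-bounded ∈ with chords-split ∈
    ... | inj₁ (refl , refl)             = ≤-refl
    ... | inj₂ (u , v , ∈d , refl , refl) = s≤s⁻¹ (toℕ<n v)

    chords-wide : ∀ {x y} → (x , y) ∈ chords → 2 + x ≤ y
    chords-wide ∈ with chords-split ∈
    ... | inj₁ (refl , refl) = s≤s (s≤s z≤n)
    ... | inj₂ (u , v , ∈d , refl , refl) =
      let u<v , ¬side = isDiagonal T ∈d in ≤∧≢⇒< u<v λ eq → ¬side (inj₁ (sym eq))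

    chords-nonCrossing : ∀ {x y x′ y′} → (x , y) ∈ chords → (x′ , y′) ∈ chords →
                         x < x′ → x′ < y → y < y′ → ⊥
    chords-nonCrossing ∈ ∈′ x<x′ x′<y y<y′ with chords-split ∈ | chords-split ∈′
    ... | inj₁ (refl , refl) | _ = <⇒≱ y<y′ (chords-bounded ∈′)
    ... | inj₂ _ | inj₁ (refl , refl) = n≮0 x<x′
    ... | inj₂ (_ , _ , ∈d , refl , refl) | inj₂ (_ , _ , ∈d′ , refl , refl) =
      nonCrossing T ∈d ∈d′ (x<x′ , x′<y , y<y′)

    open NonCrossingChords chords chords-unique chords-wide chords-nonCrossing

    -- The n - 3 diagonals and the added base make n - 2 chords, the maximum over 0, ..., n - 1;
    -- here n = 3 + k.
    chords-full : Full 0 (2 + k)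
    chords-full = ≤-reflexive (sym (begin
      #within 0 (2 + k) + 1
        ≡⟨ cong (λ xs → length xs + 1)
             (filter-all (within? 0 (2 + k)) (All.tabulate λ ∈ → z≤n , chords-bounded ∈)) ⟩
      suc (length (map chord (diagonals T))) + 1
        ≡⟨ cong (λ l → suc l + 1) (length-map chord (diagonals T)) ⟩
      suc (length (diagonals T)) + 1
        ≡⟨ cong (λ l → suc l + 1) (count T) ⟩
      suc k + 1
        ≡⟨ +-comm (suc k) 1 ⟩
      2 + k ∎))
      where open ≡-Reasoning

    Edge⇒E : ∀ {u v} → Edge T (u , v) → E (toℕ u) (toℕ v)
    Edge⇒E (inj₁ (inj₁ v≡1+u))       = inj₁ v≡1+u
    Edge⇒E (inj₁ (inj₂ (u≡0 , v≡k))) = inj₂ (here (cong₂ _,_ u≡0 (suc-injective v≡k)))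
    Edge⇒E (inj₂ ∈d)                 = inj₂ (there (∈-map⁺ chord ∈d))

    E⇒Edge : ∀ {u v} → E (toℕ u) (toℕ v) → Edge T (u , v)
    E⇒Edge (inj₁ v≡1+u)     = inj₁ (inj₁ v≡1+u)
    E⇒Edge (inj₂ (here eq)) = inj₁ (inj₂ (cong proj₁ eq , cong suc (cong proj₂ eq)))
    E⇒Edge (inj₂ (there ∈)) with d , ∈d , eq ← ∈-map⁻ chord ∈ =
      inj₂ (subst (_∈ diagonals T) (sym (chord-injective eq)) ∈d)

    vertex : ∀ {a} → a ≤ 2 + k → ∃[ v ] toℕ v ≡ a
    vertex a≤ = fromℕ< (s≤s a≤) , toℕ-fromℕ< (s≤s a≤)

    cells-unique : Unique (map corners (cells T))
    cells-unique = Unique.map⁺ corners-injective (Unique.filter⁺ (cell? T)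
      (Unique.cartesianProduct⁺ (Unique.allFin⁺ n)
        (Unique.cartesianProduct⁺ (Unique.allFin⁺ n) (Unique.allFin⁺ n))))

    -- Neither list has repetitions, so equality of their members suffices. Cells can then be
    -- counted at a vertex in either list.
    cells↭triangles : (t : Tri 0 (2 + k)) → All IsCell (triangles t) →
                      map corners (cells T) ↭ triangles t
    cells↭triangles t areCells =
      ∼bag⇒↭ (unique∧set⇒bag cells-unique (triangles-unique t) (mk⇔ to from))
      where
      triples = cartesianProduct (allFin n) (cartesianProduct (allFin n) (allFin n))
      to : ∀ {s} → s ∈ map corners (cells T) → s ∈ triangles t
      to ∈ with (x , y , z) , ∈c , refl ← ∈-map⁻ corners ∈
        with _ , order , xy , yz , xz ← ∈-filter⁻ (cell? T) {xs = triples} ∈c =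
        triangles-complete t areCells (order , Edge⇒E xy , Edge⇒E yz , Edge⇒E xz)
          (z≤n , order , s≤s⁻¹ (toℕ<n z))
      from : ∀ {s} → s ∈ triangles t → s ∈ map corners (cells T)
      from {a , b , c} ∈ with All.lookup areCells ∈ | All.lookup (triangles-span t) ∈
      ... | _ , ab , bc , ac | _ , (a<b , b<c) , c≤
        with x , refl ← vertex (≤-trans (<⇒≤ a<b) (≤-trans (<⇒≤ b<c) c≤))
           | y , refl ← vertex (≤-trans (<⇒≤ b<c) c≤)
           | z , refl ← vertex c≤
        = ∈-map⁺ corners (∈-filter⁺ (cell? T)
            (∈-cartesianProduct⁺ (∈-allFin x) (∈-cartesianProduct⁺ (∈-allFin y) (∈-allFin z)))
            ((a<b , b<c) , E⇒Edge ab , E⇒Edge bc , E⇒Edge ac))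

    cellCount≡deg : (t : Tri 0 (2 + k)) → All IsCell (triangles t) →
                    ∀ v → cellCount T v ≡ deg t (toℕ v)
    cellCount≡deg t areCells v = trans
      (length-filter-map (_isVertexOf?_ T v) (touches? (toℕ v)) corners touch untouch (cells T))
      (↭-length (filter-↭ (touches? (toℕ v)) (cells↭triangles t areCells)))
      where
      touch : ∀ {s} → _isVertexOf_ T v s → corners s touches toℕ v
      touch (inj₁ refl)        = inj₁ refl
      touch (inj₂ (inj₁ refl)) = inj₂ (inj₁ refl)
      touch (inj₂ (inj₂ refl)) = inj₂ (inj₂ refl)
      untouch : ∀ {s} → corners s touches toℕ v → _isVertexOf_ T v s
      untouch (inj₁ eq)        = inj₁ (toℕ-injective eq)
      untouch (inj₂ (inj₁ eq)) = inj₂ (inj₁ (toℕ-injective eq))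
      untouch (inj₂ (inj₂ eq)) = inj₂ (inj₂ (toℕ-injective eq))

    baseTri : ∃[ t ] ∀ v → cellCount T v ≡ deg {0} {2 + k} t (toℕ v)
    baseTri =
      let _ , t , areCells =
            triangulate (2 + k) (s≤s z≤n) (≤-reflexive (sym (+-identityʳ (2 + k)))) chords-full
      in t , cellCount≡deg t areCells

    quiddity-% : ∀ {u v} → u %ℕ n ≡ v %ℕ n → quiddity T u ≡ quiddity T v
    quiddity-% {u} {v} eq = cong (cellCount T) (toℕ-injective
      (trans (toℕ-fromℕ< (n%ℕd<d u n)) (trans eq (sym (toℕ-fromℕ< (n%ℕd<d v n))))))

    quiddity-shift : ∀ u q → quiddity T (u ℤ.+ q ℤ.* + n) ≡ quiddity T u
    quiddity-shift u q = quiddity-% {u ℤ.+ q ℤ.* + n} {u} (%ℕ-unique _ (u %ℕ n) (u /ℕ n ℤ.+ q)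
      (trans (cong (ℤ._+ q ℤ.* + n) (a≡a%ℕn+[a/ℕn]*n u n)) (regroup (+ (u %ℕ n)) (u /ℕ n) q (+ n)))
      (n%ℕd<d u n))
      where
      regroup : ∀ r a b m → r ℤ.+ a ℤ.* m ℤ.+ b ℤ.* m ≡ r ℤ.+ (a ℤ.+ b) ℤ.* m
      regroup = solve-∀

    MatchesAt : (s : ℕ) → Tri s (s + (2 + k)) → ℤ → Set
    MatchesAt s t i = ∀ m → m < n → deg t (s + m) ≡ quiddity T (i ℤ.+ + m)

    baseTri-matches : MatchesAt 0 (proj₁ baseTri) (+ 0)
    baseTri-matches m m<n = trans
      (cong (deg (proj₁ baseTri)) (sym (trans (toℕ-fromℕ< (n%ℕd<d (+ m) n)) (m<n⇒m%n≡m m<n))))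
      (sym (proj₂ baseTri (fromℕ< (n%ℕd<d (+ m) n))))

    -- A `side` is a polygon without cells, so rotating against it only renames the vertex s as s +
    -- n.
    rotate-matches : ∀ s t → MatchesAt s t (+ s) → MatchesAt (suc s) (rotate t side) (+ suc s)
    rotate-matches s t t≡ m m<n with m≤n⇒m<n∨m≡n (s≤s⁻¹ m<n)
    ... | inj₁ m<2+k = begin
      deg (rotate t side) (suc s + m)
        ≡⟨ deg-rotate t side (s≤s (m≤m+n s m)) (s≤s (+-monoʳ-< s m<2+k)) ⟩
      deg t (suc s + m) + 0            ≡⟨ +-identityʳ _ ⟩
      deg t (suc s + m)                ≡⟨ cong (deg t) (+-suc s m) ⟨
      deg t (s + suc m)                ≡⟨ t≡ (suc m) (s≤s m<2+k) ⟩
      quiddity T (+ (s + suc m))       ≡⟨ cong (λ v → quiddity T (+ v)) (+-suc s m) ⟩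
      quiddity T (+ (suc s + m))       ∎
      where open ≡-Reasoning
    -- The new last vertex s + n inherits the cells of s, in accordance with the period n.
    ... | inj₂ refl = begin
      deg (rotate t side) (suc s + m)  ≡⟨ deg-rotate-last t side ⟩
      deg t s + 0                      ≡⟨ +-identityʳ _ ⟩
      deg t s                          ≡⟨ cong (deg t) (+-identityʳ s) ⟨
      deg t (s + 0)                    ≡⟨ t≡ 0 (s≤s z≤n) ⟩
      quiddity T (+ (s + 0))           ≡⟨ cong (λ v → quiddity T (+ v)) (+-identityʳ s) ⟩
      quiddity T (+ s)                 ≡⟨ quiddity-shift (+ s) (+ 1) ⟨
      quiddity T (+ s ℤ.+ + 1 ℤ.* + n) ≡⟨ cong (λ z → quiddity T (+ s ℤ.+ z)) (ℤ.*-identityˡ (+ n)) ⟩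
      quiddity T (+ (s + n))           ≡⟨ cong (λ v → quiddity T (+ v)) (+-suc s m) ⟩
      quiddity T (+ (suc s + m))       ∎
      where open ≡-Reasoning

    triFrom : ∀ s → ∃[ t ] MatchesAt s t (+ s)
    triFrom zero    = proj₁ baseTri , baseTri-matches
    triFrom (suc s) =
      rotate (proj₁ (triFrom s)) side , rotate-matches s (proj₁ (triFrom s)) (proj₂ (triFrom s))

    -- Rotation reaches only starting points s ≥ 0; an arbitrary integer i is replaced by its
    -- residue modulo n.
    window : ∀ i → ∃[ s ] ∃[ t ] MatchesAt s t i
    window i = s , proj₁ (triFrom s) , λ m m<n → trans (proj₂ (triFrom s) m m<n) (begin
      quiddity T (+ s ℤ.+ + m)
        ≡⟨ quiddity-shift (+ s ℤ.+ + m) q ⟨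
      quiddity T (+ s ℤ.+ + m ℤ.+ q ℤ.* + n)
        ≡⟨ cong (quiddity T) (regroup (+ s) (+ m) (q ℤ.* + n)) ⟩
      quiddity T (+ s ℤ.+ q ℤ.* + n ℤ.+ + m)
        ≡⟨ cong (λ z → quiddity T (z ℤ.+ + m)) (a≡a%ℕn+[a/ℕn]*n i n) ⟨
      quiddity T (i ℤ.+ + m) ∎)
      where
      open ≡-Reasoning
      s = i %ℕ n
      q = i /ℕ n
      regroup : ∀ a b c → a ℤ.+ b ℤ.+ c ≡ a ℤ.+ c ℤ.+ b
      regroup = solve-∀

module Friezes where

  open import Data.Integer.Base using (+_)
  open import Data.Nat.Base
  open import Data.Nat.Properties
  open AbelianGroup ℤ.+-0-abelianGroup using (∙-cancelˡ)
  open Polynomials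
  open Triangulations
  open Quiddities

  -- Solutions of the recurrence on a triangulated polygon.

  Step : (ℕ → ℤ[q]) → ℕ → ℕ → Set
  Step g d v = g (pred v) ≈ᵖ [ d ]q *ᵖ g v +ᵖ (-ᵖ (q^ pred d)) *ᵖ g (suc v)

  Solves : ∀ {x y} → Tri x y → (ℕ → ℤ[q]) → Set
  Solves {x} {y} t g = ∀ v → x < v → v < y → Step g (deg t v) v

  size : ∀ {x y} → Tri x y → ℕ
  size side       = 0
  size (glue l r) = suc (size l + size r)

  module _ (g : ℕ → ℤ[q]) where

    solves-left : ∀ {x b y} (l : Tri x b) (r : Tri b y) → Solves (glue l r) g → Solves l g
    solves-left l r sol v x<v v<b = subst (λ d → Step g d v)
      (deg-glue-left l r x<v v<b) (sol v x<v (<-trans v<b (Tri⇒< r)))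

    solves-right : ∀ {x b y} (l : Tri x b) (r : Tri b y) → Solves (glue l r) g → Solves r g
    solves-right l r sol v b<v v<y = subst (λ d → Step g d v)
      (deg-glue-right l r b<v v<y) (sol v (<-trans (Tri⇒< l) b<v) v<y)

    EdgeRelOf : ∀ {x y} → Tri x y → Set
    EdgeRelOf {x} {y} t = EdgeRel (size t) (deg t x) (deg t y) (g x) (g (suc x)) (g (pred y)) (g y)

    mutual
      edgeRelOf : ∀ {x y} (t : Tri x y) → Solves t g → EdgeRelOf t
      edgeRelOf side _ = edgeRel-side _ _
      edgeRelOf (glue l r) sol rewrite deg-glue-first l r | deg-glue-last l r =
        edgeRel-glue (edgeRelOf l (solves-left l r sol)) (edgeRelOf r (solves-right l r sol))
          (apexRel l r sol)

      apexRel : ∀ {x b y} (l : Tri x b) (r : Tri b y) → Solves (glue l r) g →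
                (q^ size l) *ᵖ g b ≈ᵖ (q^ (size l + size r)) *ᵖ g y +ᵖ g x
      apexRel {b = b} l r sol =
        edgeRel-apex (edgeRelOf l (solves-left l r sol)) (edgeRelOf r (solves-right l r sol))
          (subst (λ d → Step g d b) (deg-glue-apex l r) (sol b (Tri⇒< l) (Tri⇒< r)))

    -- The apex equation makes g(b) positive, and both halves then satisfy the same hypotheses. At x
    -- only nonnegativity is assumed, since in the application g(x) is zero.
    solution-positive : ∀ {x y} (t : Tri x y) → Solves t g → NonNeg (g x) → Positive (g y) →
                        ∀ v → x < v → v ≤ y → Positive (g v)
    solution-positive side sol gx≥0 gy>0 v x<v v≤y =
      subst (λ v → Positive (g v)) (≤-antisym x<v v≤y) gy>0
    solution-positive {x} {y} (glue {b = b} l r) sol gx≥0 gy>0 v x<v v≤y = choose (v ≤? b)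
      where
      gb>0 : Positive (g b)
      gb>0 = Positive-q^⁻¹ (size l) (apexRel l r sol)
        (Positive-+ (Positive-q^ (size l + size r) gy>0) gx≥0)
      choose : Dec (v ≤ b) → Positive (g v)
      choose (yes v≤b) = solution-positive l (solves-left l r sol) gx≥0 gb>0 v x<v v≤b
      choose (no  v≰b) =
        solution-positive r (solves-right l r sol) (nonNegative gb>0) gy>0 v (≰⇒> v≰b) v≤y

    -- The extra hypothesis is the recurrence at y with g(y+1) = 0. Compared with the right relation
    -- along the base edge it leaves q^r g(x) = 0.
    solution-closes : ∀ {x y} (t : Tri x y) → Solves t g →
                      g (pred y) ≈ᵖ [ deg t y ]q *ᵖ g y → g x ≈ᵖ 0ᵖ
    solution-closes {x} {y} t sol last = q^-cancel (deg t y) (because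
      (+ᵖ-cong (≈-sym (atRight (edgeRelOf t sol))) (*ᵖ-congˡ (q^ size t) last))
      (solve 6 (λ R E [r] gx gy gy⁻ → R :* gx :+ (E :* gy⁻ :+ E :* ([r] :* gy))
                           := R :* con 0ᵖ :+ ((E :* [r] :* gy :+ R :* gx) :+ E :* gy⁻))
         ≈-refl (q^ deg t y) (q^ size t) [ deg t y ]q (g x) (g y) (g (pred y))))

  K-singleton : ∀ c → K (c ∷ []) ≈ᵖ [ c ]q
  K-singleton c =
    solve 2 (λ a b → a :* con 1ᵖ :+ b :* con 0ᵖ := a) ≈-refl [ c ]q (-ᵖ (q^ pred c))

  suc-+ : ∀ i m → ℤ.suc (i ℤ.+ + m) ≡ i ℤ.+ + suc m
  suc-+ i m = lemma i (+ m)
    where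
    lemma : ∀ i m → 1ℤ ℤ.+ (i ℤ.+ m) ≡ i ℤ.+ (1ℤ ℤ.+ m)
    lemma = solve-∀

  module Closing (c : ℤ → ℕ) {k s : ℕ} (t : Tri s (s + suc k)) (i : ℤ)
    (matches : ∀ m → m < 2 + k → deg t (s + m) ≡ c (i ℤ.+ + m)) where
    private n = 2 + k

    -- The entry ζ_{i+m,ℓ} with ℓ = i + n fixed; `g` is the same sequence indexed by the vertices s,
    -- s + 1, ... of the tree.
    z : ℕ → ℤ[q]
    z m = Z c (i ℤ.+ + m) (n ∸ m)

    g : ℕ → ℤ[q]
    g v = z (v ∸ s)

    g-at : ∀ m → g (s + m) ≡ z m
    g-at m = cong z (m+n∸m≡n s m)

    z-step : ∀ m → 2 + m ≤ n →
      z m ≈ᵖ [ c (i ℤ.+ + suc m) ]q *ᵖ z (suc m) +ᵖ (-ᵖ (q^ pred (c (i ℤ.+ + suc m)))) *ᵖ z (2 + m)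
    z-step m 2+m≤n with n ∸ m | +-∸-assoc 2 2+m≤n | n ∸ suc m | +-∸-assoc 1 2+m≤n
    ... | _ | refl | _ | refl rewrite sym (suc-+ i (suc m)) | sym (suc-+ i m) = ≈-refl

    -- The range of m includes the last vertex s + n - 1, where the next value is ζ_{ℓ,ℓ} = 0;
    -- `g-last` uses this case and `g-solves` the others.
    g-step : ∀ m → 2 + m ≤ n → Step g (deg t (s + suc m)) (s + suc m)
    g-step m 2+m≤n rewrite matches (suc m) 2+m≤n | g-at (suc m)
      | cong (λ v → g (pred v)) (+-suc s m) | g-at m
      | cong g (sym (+-suc s (suc m))) | g-at (2 + m) = z-step m 2+m≤n

    g-solves : Solves t g
    g-solves v s<v v<y with m≤n⇒∃[o]m+o≡n s<v
    ... | m , refl = subst (λ v → Step g (deg t v) v) (+-suc s m)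
      (g-step m (m≤n⇒m≤1+n (+-cancelˡ-< s (suc m) (suc k)
        (subst (_< s + suc k) (sym (+-suc s m)) v<y))))

    z-last : z (suc k) ≡ 1ᵖ
    z-last = cong (λ m → Z c (i ℤ.+ + suc k) m) (m+n∸n≡m 1 (suc k))

    z-beyond : z n ≡ 0ᵖ
    z-beyond = cong (λ m → Z c (i ℤ.+ + n) m) (n∸n≡0 n)

    g-last : g (pred (s + suc k)) ≈ᵖ [ deg t (s + suc k) ]q *ᵖ g (s + suc k)
    g-last = because (g-step k ≤-refl) (≈-trans
      (+ᵖ-cong (≈-refl {g (pred (s + suc k))}) (+ᵖ-cong ≈-refl (*ᵖ-congˡ (-ᵖ (q^ pred d))
        (subst (_≈ᵖ 0ᵖ) (sym (trans (cong g (sym (+-suc s (suc k)))) (trans (g-at n) z-beyond))) ≈-refl))))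
      (solve 3 (λ a b e → a :+ (b :+ e :* con 0ᵖ) := b :+ a) ≈-refl
        (g (pred (s + suc k))) ([ d ]q *ᵖ g (s + suc k)) (-ᵖ (q^ pred d))))
      where d = deg t (s + suc k)

    gs≈0 : g s ≈ᵖ 0ᵖ
    gs≈0 = solution-closes g t g-solves g-last

    z₀≈0 : z 0 ≈ᵖ 0ᵖ
    z₀≈0 = subst (_≈ᵖ 0ᵖ) (trans (cong g (sym (+-identityʳ s))) (g-at 0)) gs≈0

    z-positive : ∀ m → 0 < m → m ≤ suc k → Positive (z m)
    z-positive m 0<m m≤ = subst Positive (g-at m) (solution-positive g t g-solves
      (NonNeg-≈ {0ᵖ} (≈-sym gs≈0) (λ _ → ℤ.≤-refl))
      (subst Positive (sym (trans (g-at (suc k)) z-last)) (positive 0≤1 1≉0))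
      (s + m) (m<m+n s 0<m) (+-monoʳ-≤ s m≤))
      where
      0≤1 : NonNeg 1ᵖ
      0≤1 zero    = ℤ.+≤+ z≤n
      0≤1 (suc m) = ℤ.≤-refl

  -- Positivity and computation of the frieze entries.

  -- c is the quiddity of a triangulated (2 + k)-gon, seen from every one of its vertices.
  Windows : (ℤ → ℕ) → ℕ → Set
  Windows c k = ∀ i → ∃[ s ] ∃[ t ]
                ∀ m → m < 2 + k → deg {s} {s + suc k} t (s + m) ≡ c (i ℤ.+ + m)

  module _ (c : ℤ → ℕ) {k : ℕ} (windows : Windows c k) where

    Z-closes : ∀ i → Z c i (2 + k) ≈ᵖ 0ᵖ
    Z-closes i with s , t , matches ← windows i =
      subst (λ i → Z c i (2 + k) ≈ᵖ 0ᵖ) (ℤ.+-identityʳ i) (Closing.z₀≈0 c t i matches)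

    Z-positive : ∀ i m → m < suc k → Positive (Z c i (suc m))
    -- The entry ends at ℓ = i + m + 1, so the window must start at ℓ - n, which is i - (k + 1 - m)
    -- for n = 2 + k.
    Z-positive i m m<1+k with s , t , matches ← windows (i ℤ.- + (suc k ∸ m)) =
      subst₂ (λ i m → Positive (Z c i m)) (cancel i (+ (suc k ∸ m)))
        (trans (+-∸-assoc 1 (m∸n≤m (suc k) m)) (cong suc (m∸[m∸n]≡n (<⇒≤ m<1+k))))
        (Closing.z-positive c t (i ℤ.- + (suc k ∸ m)) matches (suc k ∸ m)
          (m<n⇒0<n∸m m<1+k) (m∸n≤m (suc k) m))
      where
      cancel : ∀ i a → i ℤ.- a ℤ.+ a ≡ i
      cancel = solve-∀

    -- An entry of width w is obtained by dividing by one of width w - 2. For 3 ≤ w ≤ n + 1 the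
    -- divisor has width between 1 and n - 1, where entries are positive; the vanishing entries of
    -- width n would first be divisors at w = n + 2.
    friezeEntry≐Z : ∀ i m → m ≤ 3 + k → friezeEntry c i m ≐ Z c i m
    friezeEntry≐Z i 0 _ = just ≈-refl
    friezeEntry≐Z i 1 _ = just ≈-refl
    friezeEntry≐Z i 2 _ = just (*ᵖ-cong (≈-sym (K-singleton (c (ℤ.suc i)))) ≈-refl)
    friezeEntry≐Z i (suc (suc (suc m))) m≤ = unfold
      (friezeEntry≐Z i (suc (suc m)) (≤-trans (n≤1+n _) m≤))
      (friezeEntry≐Z i′ (suc (suc m)) (≤-trans (n≤1+n _) m≤))
      (friezeEntry≐Z i′ (suc m) (≤-trans (n≤1+n _) (≤-trans (n≤1+n _) m≤)))
      where
      i′ = ℤ.suc i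
      Q = q^ sum (map pred (run c i′ (suc m)))
      unfold : ∀ {x y z} → x ≐ Z c i (suc (suc m)) → y ≐ Z c i′ (suc (suc m)) → z ≐ Z c i′ (suc m) →
               (x >>= λ x → y >>= λ y → z >>= λ z → (x *ʳ y -ʳ ι Q) ÷ z) ≐ Z c i (3 + m)
      unfold (just {x} x≈) (just {y} y≈) (just {z} z≈) with num z ≈0?
      ... | yes z≈0 = ⊥-elim (*-≉0 (nonvanishing (Z-positive i′ m (s≤s⁻¹ (s≤s⁻¹ m≤)))) (den≉0 z)
                        (≈-trans (≈-sym z≈) (*ᵖ-cong z≈0 ≈-refl)))
      -- After clearing denominators, the two factors and the divisor are replaced by continuants,
      -- for which the unimodular rule is already known.
      ... | no _ = just (because
        (+ᵖ-cong
          (+ᵖ-cong (*ᵖ-congˡ (den z) (*ᵖ-cong x≈ y≈))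
                   (*ᵖ-congˡ (den x *ᵖ den y *ᵖ den z) (unimodular c i (suc m))))
          (*ᵖ-congˡ (den x *ᵖ den y *ᵖ Z c i (3 + m)) (≈-sym z≈)))
        (solve 11 (λ nx dx ny dy nz dz X Y Z W Q →
            (((nx :* ny) :* con 1ᵖ :+ (:- (Q :* (dx :* dy)))) :* dz) :* con 1ᵖ
              :+ ((dz :* ((X :* dx) :* (Y :* dy)) :+ dx :* dy :* dz :* Q)
                 :+ dx :* dy :* W :* (nz :* con 1ᵖ))
            := W :* (((dx :* dy) :* con 1ᵖ) :* nz)
              :+ ((dz :* ((nx :* con 1ᵖ) :* (ny :* con 1ᵖ))
                  :+ dx :* dy :* dz :* (X :* Y :+ (:- (Z :* W))))
                 :+ dx :* dy :* W :* (Z :* dz)))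
          ≈-refl (num x) (den x) (num y) (den y) (num z) (den z)
          (Z c i (2 + m)) (Z c i′ (2 + m)) (Z c i′ (1 + m)) (Z c i (3 + m)) Q))

  -- Continued fractions as quotients of continuants.

  fin≈/¹ : ∀ x {p r} → r ≉ᵖ 0ᵖ → num x *ᵖ r ≈ᵖ p *ᵖ den x → fin x ≈¹ (p /¹ r)
  fin≈/¹ x {r = r} r≉0 x≈p/r with r ≈0?
  ... | yes r≈0 = ⊥-elim (r≉0 r≈0)
  ... | no _    = fin≈ x≈p/r

  fin≈/¹⁻¹ : ∀ {z p r} → r ≉ᵖ 0ᵖ → z ≈¹ (p /¹ r) → ∃[ x ] z ≡ fin x × num x *ᵖ r ≈ᵖ p *ᵖ den x
  fin≈/¹⁻¹ {r = r} r≉0 z≈ with r ≈0? | z≈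
  ... | yes r≈0 | _        = ⊥-elim (r≉0 r≈0)
  ... | no _    | fin≈ x≈ = _ , refl , x≈

  -- K (c ∷ cs) / K cs = [c] - q^{c-1} / (K cs / κ cs)
  ⊖⊘-continuant : ∀ c cs {z} → K cs ≉ᵖ 0ᵖ → κ cs ≉ᵖ 0ᵖ → z ≈¹ (K cs /¹ κ cs) →
                  (ι [ c ]q ⊖ ι (q^ pred c) ⊘ z) ≈¹ (K (c ∷ cs) /¹ K cs)
  ⊖⊘-continuant c cs K≉0 κ≉0 z≈ with x , refl , x≈ ← fin≈/¹⁻¹ {p = K cs} κ≉0 z≈ with num x ≈0?
  ... | yes x≈0 = ⊥-elim (*-≉0 K≉0 (den≉0 x) (≈-trans (≈-sym x≈) (*ᵖ-cong x≈0 ≈-refl)))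
  ... | no x≉0 = fin≈/¹ (ι [ c ]q -ʳ divide (ι (q^ pred c)) x x≉0) K≉0
    (because (*ᵖ-congˡ (q^ pred c) x≈)
    (solve 6 (λ [c] C N D k κ →
        ([c] :* (con 1ᵖ :* N) :+ (:- ((C :* D) :* con 1ᵖ))) :* k :+ C :* (k :* D)
        := ([c] :* k :+ (:- C) :* κ) :* (con 1ᵖ :* (con 1ᵖ :* N)) :+ C :* (N :* κ))
      ≈-refl [ c ]q (q^ pred c) (num x) (den x) (K cs) (κ cs)))

  module _ (c : ℤ → ℕ) {k : ℕ} (windows : Windows c k) where

    Z≉0 : ∀ i m → m < suc k → Z c i (suc m) ≉ᵖ 0ᵖ
    Z≉0 i m m< = nonvanishing (Z-positive c windows i m m<)

    -- Only denominators have to be nonzero here. The numerator may vanish, as it does for n - 1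
    -- terms, where the value is 0.
    continuedFraction : ∀ i m → m ≤ suc k → [[ run c i m ]]q ≈¹ (K (run c i m) /¹ κ (run c i m))
    continuedFraction i 0 _ = 1/0≈
    continuedFraction i 1 _ = fin≈/¹ (ι [ c i ]q) 1≉0
      (*ᵖ-cong (≈-sym (K-singleton (c i))) ≈-refl)
    continuedFraction i (suc (suc m)) m≤ = ⊖⊘-continuant (c i) (run c (ℤ.suc i) (suc m))
      (Z≉0 i (suc m) m≤) (Z≉0 (ℤ.suc i) m (<⇒≤ m≤)) (continuedFraction (ℤ.suc i) (suc m) (<⇒≤ m≤))

  -- Index bookkeeping and assembly of the claims.

  run-∷ʳ : ∀ c i m → run c i (suc m) ≡ run c i m ∷ʳ c (i ℤ.+ + m)
  run-∷ʳ c i zero    = cong (λ i → c i ∷ []) (sym (ℤ.+-identityʳ i))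
  run-∷ʳ c i (suc m) = cong (c i ∷_) (trans (run-∷ʳ c (ℤ.suc i) m)
    (cong (λ j → run c (ℤ.suc i) m ∷ʳ c j) (trans (ℤ.+-assoc 1ℤ i (+ m)) (suc-+ i m))))

  ⟨⋯⟩≡run : ∀ c {i j m} → ℤ.suc j ℤ.- i ≡ + m → c ⟨ i ⋯ j ⟩ ≡ run c i m
  ⟨⋯⟩≡run c {i} {j} eq with ℤ.suc j ℤ.- i | eq
  ... | _ | refl = refl

  frieze≡friezeEntry : ∀ {n} .{{_ : NonZero n}} (T : Triangulation n) {k ℓ m} → ℓ ℤ.- k ≡ + m →
                       frieze T k ℓ ≡ friezeEntry (quiddity T) k m
  frieze≡friezeEntry T {k} {ℓ} eq with ℓ ℤ.- k | eq
  ... | _ | refl = refl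

  ≐-cong : ∀ {z p r} → p ≈ᵖ r → z ≐ p → z ≐ r
  ≐-cong p≈r (just z≈p) = just (≈-trans z≈p (*ᵖ-cong p≈r ≈-refl))

  -- `κ` discards the first term of its run, so a continuant starting at i is a frieze entry in row
  -- i - 1.
  K-run : ∀ c i m → K (run c i m) ≡ Z c (i ℤ.- + 1) (suc m)
  K-run c i m = cong (λ i → K (run c i m)) (cancel i)
    where
    cancel : ∀ i → i ≡ 1ℤ ℤ.+ (i ℤ.- 1ℤ)
    cancel = solve-∀

  module Indices {i j : ℤ} {m : ℕ} (j-i≡m : j ℤ.- i ≡ + m) where

    shift : ∀ {x} a → x ≡ + a ℤ.+ (j ℤ.- i) → x ≡ + (a + m)
    shift a x≡ = trans x≡ (cong (λ d → + a ℤ.+ d) j-i≡m)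

    suc-j-i : ℤ.suc j ℤ.- i ≡ + suc m
    suc-j-i = shift 1 (identity i j)
      where
      identity : ∀ i j → 1ℤ ℤ.+ j ℤ.- i ≡ 1ℤ ℤ.+ (j ℤ.- i)
      identity = solve-∀

    suc-[j-1]-i : ℤ.suc (j ℤ.- + 1) ℤ.- i ≡ + m
    suc-[j-1]-i = shift 0 (identity i j)
      where
      identity : ∀ i j → 1ℤ ℤ.+ (j ℤ.- 1ℤ) ℤ.- i ≡ 0ℤ ℤ.+ (j ℤ.- i)
      identity = solve-∀

    [j+1]-[i-1] : (j ℤ.+ + 1) ℤ.- (i ℤ.- + 1) ≡ + (2 + m)
    [j+1]-[i-1] = shift 2 (identity i j)
      where
      identity : ∀ i j → (j ℤ.+ 1ℤ) ℤ.- (i ℤ.- 1ℤ) ≡ + 2 ℤ.+ (j ℤ.- i)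
      identity = solve-∀

    j-[i-1] : j ℤ.- (i ℤ.- + 1) ≡ + suc m
    j-[i-1] = shift 1 (identity i j)
      where
      identity : ∀ i j → j ℤ.- (i ℤ.- 1ℤ) ≡ 1ℤ ℤ.+ (j ℤ.- i)
      identity = solve-∀

    [j+1]-i : (j ℤ.+ + 1) ℤ.- i ≡ + suc m
    [j+1]-i = shift 1 (identity i j)
      where
      identity : ∀ i j → (j ℤ.+ 1ℤ) ℤ.- i ≡ 1ℤ ℤ.+ (j ℤ.- i)
      identity = solve-∀

    i+m≡j : i ℤ.+ + m ≡ j
    i+m≡j = trans (cong (λ d → i ℤ.+ d) (sym j-i≡m)) (identity i j)
      where
      identity : ∀ i j → i ℤ.+ (j ℤ.- i) ≡ j
      identity = solve-∀

  ≤⇒+ : ∀ {i j} → i ℤ.≤ j → ∃[ m ] j ℤ.- i ≡ + m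
  ≤⇒+ {i} {j} i≤j = ℤ.∣ j ℤ.- i ∣ , sym (ℤ.0≤i⇒+∣i∣≡i (ℤ.i≤j⇒0≤j-i i≤j))

  gap≤ : ∀ {i j b m} → j ℤ.- i ≡ + m → j ℤ.≤ i ℤ.+ + b → m ≤ b
  gap≤ {i} {j} {b} j-i≡m j≤ = ℤ.drop‿+≤+
    (subst₂ ℤ._≤_ j-i≡m (identity i (+ b)) (ℤ.+-monoˡ-≤ (ℤ.- i) j≤))
    where
    identity : ∀ i b → i ℤ.+ b ℤ.- i ≡ b
    identity = solve-∀

  gap-unique : ∀ {i m m′} → i ℤ.+ + m ≡ i ℤ.+ + m′ → m ≡ m′
  gap-unique {i} eq = ℤ.+-injective (∙-cancelˡ i _ _ eq)

  i+[3+k]-2≡i+[1+k] : ∀ i k → i ℤ.+ + (3 + k) ℤ.- + 2 ≡ i ℤ.+ + suc k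
  i+[3+k]-2≡i+[1+k] i k = identity i (+ k)
    where
    identity : ∀ i k → i ℤ.+ (+ 3 ℤ.+ k) ℤ.- + 2 ≡ i ℤ.+ (1ℤ ℤ.+ k)
    identity = solve-∀

  -- Here n = 3 + k, while `Windows` counts n as 2 plus its argument, whence `suc k`.
  module FriezeOf (c : ℤ → ℕ) {k : ℕ} (windows : Windows c (suc k)) (ζ : ℤ → ℤ → Maybe ℚ⟨q⟩)
    (ζ≡friezeEntry : ∀ {i j m} → j ℤ.- i ≡ + m → ζ i j ≡ friezeEntry c i m) where

    ζ≐Z : ∀ {i j m} → j ℤ.- i ≡ + m → m ≤ 4 + k → ζ i j ≐ Z c i m
    ζ≐Z {i} {j} {m} j-i≡m m≤ = subst (_≐ Z c i m) (sym (ζ≡friezeEntry j-i≡m))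
      (friezeEntry≐Z c windows i m m≤)

    polynomial : ∀ i j → i ℤ.≤ j → j ℤ.≤ i ℤ.+ + (3 + k) ℤ.+ + 1 → ∃[ p ] (ζ i j ≐ p)
    polynomial i j i≤j j≤ =
      let m , j-i≡m = ≤⇒+ i≤j
      in Z c i m , ζ≐Z j-i≡m (gap≤ j-i≡m (subst (j ℤ.≤_) (identity i (+ k)) j≤))
      where
      identity : ∀ i k → i ℤ.+ (+ 3 ℤ.+ k) ℤ.+ + 1 ≡ i ℤ.+ (+ 4 ℤ.+ k)
      identity = solve-∀

    module _ (i j : ℤ) {m : ℕ} (j-i≡m : j ℤ.- i ≡ + m) (m≤1+k : m ≤ suc k) where
      open Indices {i} {j} j-i≡m

      i⁻ : ℤ
      i⁻ = i ℤ.- + 1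

      R R′ S S′ : ℤ[q]
      R  = Z c i⁻ (2 + m)
      R′ = Z c i⁻ (1 + m)
      S  = Z c i (1 + m)
      S′ = Z c i m

      matrix : Entrywise _≈ᵖ_ (Mq (c ⟨ i ⋯ j ⟩))
                 (mat R (-ᵖ ((q^ pred (c j)) *ᵖ R′)) S (-ᵖ ((q^ pred (c j)) *ᵖ S′)))
      matrix = subst (λ cs → Entrywise _≈ᵖ_ (Mq cs)
          (mat R (-ᵖ ((q^ pred (c j)) *ᵖ R′)) S (-ᵖ ((q^ pred (c j)) *ᵖ S′)))) (sym run≡)
        (entrywise
          (subst (λ r → a₁₁ (Mq (cs ∷ʳ c j)) ≈ᵖ r)
            (trans (cong K (sym run∷ʳ≡)) (K-run c i (suc m)))
            (proj₁ (Mq-column₁ (cs ∷ʳ c j))))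
          (subst (λ r → a₁₂ (Mq (cs ∷ʳ c j)) ≈ᵖ -ᵖ ((q^ pred (c j)) *ᵖ r)) (K-run c i m)
            (proj₁ (Mq-column₂ cs (c j))))
          (subst (λ r → a₂₁ (Mq (cs ∷ʳ c j)) ≈ᵖ r) (cong κ (sym run∷ʳ≡))
            (proj₂ (Mq-column₁ (cs ∷ʳ c j))))
          (proj₂ (Mq-column₂ cs (c j))))
        where
        cs = run c i m
        run∷ʳ≡ : run c i (suc m) ≡ cs ∷ʳ c j
        run∷ʳ≡ = trans (run-∷ʳ c i m) (cong (λ j → cs ∷ʳ c j) i+m≡j)
        run≡ : c ⟨ i ⋯ j ⟩ ≡ cs ∷ʳ c j
        run≡ = trans (⟨⋯⟩≡run c {i} {j} suc-j-i) run∷ʳ≡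

      entries : Entrywise _≐_ (mat (ζ i⁻ (j ℤ.+ + 1)) (ζ i⁻ j) (ζ i (j ℤ.+ + 1)) (ζ i j))
                                (mat R R′ S S′)
      entries = entrywise
        (ζ≐Z [j+1]-[i-1] (s≤s (s≤s (≤-trans m≤1+k (n≤1+n _)))))
        (ζ≐Z j-[i-1] (s≤s (≤-trans m≤1+k (m≤n+m (suc k) 2))))
        (ζ≐Z [j+1]-i (s≤s (≤-trans m≤1+k (m≤n+m (suc k) 2))))
        (ζ≐Z j-i≡m (≤-trans m≤1+k (m≤n+m (suc k) 3)))

      atStart : j ≡ i → (ζ i i ≐ 0ᵖ) × (S′ ≈ᵖ 0ᵖ)
      atStart j≡i = ζ≐Z (ℤ.+-inverseʳ i) z≤n , subst (λ m → Z c i m ≈ᵖ 0ᵖ) (sym m≡0) ≈-refl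
        where
        m≡0 : m ≡ 0
        m≡0 = gap-unique {i} (trans i+m≡j (trans j≡i (sym (ℤ.+-identityʳ i))))

      atEnd : j ≡ i ℤ.+ + (3 + k) ℤ.- + 2 → (ζ i⁻ (i ℤ.+ + (3 + k) ℤ.- + 1) ≐ 0ᵖ) × (R ≈ᵖ 0ᵖ)
      atEnd j≡ = ≐-cong (Z-closes c windows i⁻) (ζ≐Z (identity i (+ (3 + k))) (n≤1+n _)) ,
        subst (λ m → Z c i⁻ (2 + m) ≈ᵖ 0ᵖ) (sym m≡1+k) (Z-closes c windows i⁻)
        where
        m≡1+k : m ≡ suc k
        m≡1+k = gap-unique {i} (trans i+m≡j (trans j≡ (i+[3+k]-2≡i+[1+k] i k)))
        identity : ∀ i n → i ℤ.+ n ℤ.- + 1 ℤ.- (i ℤ.- + 1) ≡ n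
        identity = solve-∀

      S′≉0 : j ≢ i → S′ ≉ᵖ 0ᵖ
      S′≉0 j≢i = positiveGap m refl
        where
        positiveGap : ∀ m′ → m ≡ m′ → Z c i m′ ≉ᵖ 0ᵖ
        positiveGap zero     refl = ⊥-elim (j≢i (trans (sym i+m≡j) (ℤ.+-identityʳ i)))
        positiveGap (suc m′) refl = Z≉0 c windows i m′ (≤-trans m≤1+k (n≤1+n _))

      R≉0 : j ≢ i ℤ.+ + (3 + k) ℤ.- + 2 → R ≉ᵖ 0ᵖ
      R≉0 j≢ = Z≉0 c windows i⁻ (suc m) (s≤s (≤∧≢⇒< m≤1+k λ m≡1+k →
        j≢ (trans (sym i+m≡j) (trans (cong (λ m → i ℤ.+ + m) m≡1+k) (sym (i+[3+k]-2≡i+[1+k] i k))))))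

      fraction′ : [[ c ⟨ i ⋯ j ℤ.- + 1 ⟩ ]]q ≈¹ (R′ /¹ S′)
      fraction′ = subst₂ (λ cs r → [[ cs ]]q ≈¹ (r /¹ S′))
        (sym (⟨⋯⟩≡run c {i} {j ℤ.- + 1} suc-[j-1]-i)) (K-run c i m)
        (continuedFraction c windows i m (≤-trans m≤1+k (n≤1+n _)))

      fraction : [[ c ⟨ i ⋯ j ⟩ ]]q ≈¹ (R /¹ S)
      fraction = subst₂ (λ cs r → [[ cs ]]q ≈¹ (r /¹ S))
        (sym (⟨⋯⟩≡run c {i} {j} suc-j-i)) (K-run c i (suc m))
        (continuedFraction c windows i (suc m) (s≤s m≤1+k))

open import Data.Integer.Base using (ℤ; +_; _+_; _-_; _≤_)
open import Data.Nat.Base using (ℕ; NonZero; pred) renaming (_≤_ to _≤ⁿ_)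
open import Data.Product.Base using (_×_; ∃-syntax)
open import Relation.Binary.PropositionalEquality using (_≡_; _≢_)
open Quiddities using (window)
open Friezes

proposition3p6 :
    (n : ℕ) .{{_ : NonZero n}} → 3 ≤ⁿ n → (T : Triangulation n) →
    let c = quiddity T
        ζ = frieze T
    in
    (∀ k ℓ → k ≤ ℓ → ℓ ≤ k + + n + + 1 → ∃[ p ] (ζ k ℓ ≐ p)) ×
    (∀ (i j : ℤ) → i ≤ j → j ≤ i + + n - + 2 →
      ∃[ R ] ∃[ R′ ] ∃[ S ] ∃[ S′ ]
        Entrywise _≈ᵖ_ (Mq (c ⟨ i ⋯ j ⟩))
          (mat R (-ᵖ ((q^ pred (c j)) *ᵖ R′))
               S (-ᵖ ((q^ pred (c j)) *ᵖ S′))) ×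
        Entrywise _≐_
          (mat (ζ (i - + 1) (j + + 1)) (ζ (i - + 1) j)
               (ζ i (j + + 1))         (ζ i j))
          (mat R R′
               S S′) ×
        (j ≡ i → (ζ i i ≐ 0ᵖ) × (S′ ≈ᵖ 0ᵖ)) ×
        (j ≡ i + + n - + 2 → (ζ (i - + 1) (i + + n - + 1) ≐ 0ᵖ) × (R ≈ᵖ 0ᵖ)) ×
        (R′ ≉ᵖ 0ᵖ) ×
        (S ≉ᵖ 0ᵖ) ×
        (j ≢ i → S′ ≉ᵖ 0ᵖ) ×
        (j ≢ i + + n - + 2 → R ≉ᵖ 0ᵖ) ×
        ([[ c ⟨ i ⋯ j - + 1 ⟩ ]]q ≈¹ (R′ /¹ S′)) ×
        ([[ c ⟨ i ⋯ j ⟩ ]]q ≈¹ (R /¹ S)))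
proposition3p6 (suc (suc (suc k))) (s≤s (s≤s (s≤s z≤n))) T =
  polynomial , λ i j i≤j j≤ →
    let m , j-i≡m = ≤⇒+ i≤j
        m≤1+k = gap≤ j-i≡m (subst (j ≤_) (i+[3+k]-2≡i+[1+k] i k) j≤)
    in R i j j-i≡m m≤1+k , R′ i j j-i≡m m≤1+k , S i j j-i≡m m≤1+k , S′ i j j-i≡m m≤1+k ,
       matrix i j j-i≡m m≤1+k , entries i j j-i≡m m≤1+k ,
       atStart i j j-i≡m m≤1+k , atEnd i j j-i≡m m≤1+k ,
       Z≉0 (quiddity T) (window T) (i - + 1) m (s≤s m≤1+k) ,
       Z≉0 (quiddity T) (window T) i m (s≤s m≤1+k) ,
       S′≉0 i j j-i≡m m≤1+k , R≉0 i j j-i≡m m≤1+k ,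
       fraction′ i j j-i≡m m≤1+k , fraction i j j-i≡m m≤1+k
  where
  open FriezeOf (quiddity T) (window T) (frieze T) (λ {i} {j} → frieze≡friezeEntry T {i} {j})
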